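{- Let $d\ge1$ be an integer, $0\le p<\frac12$, and let $x,y\in\{0,1\}^d$ be fixed. Let $\hat x,\hat y\in\{0,1\}^d$ be the random vectors obtained from $x$ and $y$ by flipping each bit with probability $p$ (and leaving it unchanged with probability $1-p$), all $2d$ flips being mutually independent. Put $$\mathrm{dist}^2_{\mathrm{RR}}(x,y)=\frac{\|\hat x-\hat y\|_2^2-2dp(1-p)}{(1-2p)^2}.$$ Then: 1. $\mathrm{E}[\mathrm{dist}^2_{\mathrm{RR}}(x,y)]=\|x-y\|_2^2$. 2. For every $\delta_{\mathrm{RR}}\in(0,1)$, with probability at least $1-\delta_{\mathrm{RR}}$, $$\left|\mathrm{dist}^2_{\mathrm{RR}}(x,y)-\|x-y\|_2^2\right|\le\frac{\sqrt{d\log(2/\delta_{\mathrm{RR}})}}{\sqrt2\,(1-2p)^2}.$$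
   Context: $\|\cdot\|_2$ is the Euclidean norm and $\log$ is the natural logarithm. The vectors $x,y$ represent two distinct users; $\hat x,\hat y$ are their published versions under randomized response with flipping probability $p$, and $\mathrm{dist}^2_{\mathrm{RR}}(x,y)$ is the estimate of their squared distance computed from the published vectors. -}

module Defs where

open import Algebra.Bundles using (CommutativeRing; Semiring)
open import Algebra.Structures using (IsCommutativeRing)
import Algebra.Definitions.RawSemiring as RawSemiringDefinitions
import Algebra.Properties.CommutativeSemigroup as CommutativeSemigroupProperties
import Algebra.Properties.Ring as RingProperties
import Algebra.Properties.Semiring.Mult as SemiringMult
open import Data.Bool.Base using (Bool; true; false; if_then_else_; _xor_)
open import Data.Empty using (⊥-elim)
open import Data.Nat.Base as ℕ using (ℕ; zero; suc; _!)
import Data.Nat.Properties as ℕ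
open import Data.Product.Base using (∃; _×_; _,_; proj₁; proj₂)
open import Data.Sum.Base using (inj₁; inj₂)
open import Data.Vec.Base using (Vec; []; _∷_; map; zipWith; foldr′)
open import Level using (0ℓ)
open import Relation.Binary.Bundles using (DecTotalOrder)
import Relation.Binary.Construct.NonStrictToStrict as NonStrictToStrict
open import Relation.Binary.PropositionalEquality
open import Relation.Binary.Structures using (IsDecTotalOrder)
open import Relation.Nullary using (¬_; Dec; does; yes; no)
open import Relation.Unary using (Pred; Decidable)

-- The real numbers, given by their classical axioms as a Dedekind-complete
-- ordered field (unique up to isomorphism).  The order is decidable because the
-- theory of the reals is the classical one.  The value of 0# ⁻¹ is unspecified.
-- Classically `archimedean` follows from `complete`; it is listed because
-- constructively `complete` does not produce the natural number.
record RealNumbers : Set₁ where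
  infix  8 -_
  infixl 7 _*_
  infixl 6 _+_
  infix  4 _≤_
  infix  9 _⁻¹
  field
    ℝ                 : Set
    _+_ _*_           : ℝ → ℝ → ℝ
    -_ _⁻¹            : ℝ → ℝ
    0# 1#             : ℝ
    _≤_               : ℝ → ℝ → Set
    isCommutativeRing : IsCommutativeRing _≡_ _+_ _*_ -_ 0# 1#
    isDecTotalOrder   : IsDecTotalOrder _≡_ _≤_
    0≢1               : 0# ≢ 1#
    *-inverseʳ        : ∀ {x} → x ≢ 0# → x * x ⁻¹ ≡ 1#
    +-monoˡ-≤         : ∀ z {x y} → x ≤ y → x + z ≤ y + z
    *-nonNeg          : ∀ {x y} → 0# ≤ x → 0# ≤ y → 0# ≤ x * y

  commutativeRing : CommutativeRing 0ℓ 0ℓ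
  commutativeRing = record { isCommutativeRing = isCommutativeRing }

  decTotalOrder : DecTotalOrder 0ℓ 0ℓ 0ℓ
  decTotalOrder = record { isDecTotalOrder = isDecTotalOrder }

  open CommutativeRing commutativeRing public
    using ( ring; semiring; *-commutativeSemigroup
          ; +-assoc; +-comm; +-identityˡ; +-identityʳ; -‿inverseˡ; -‿inverseʳ
          ; *-assoc; *-comm; *-identityˡ; *-identityʳ; distribˡ; distribʳ; zeroˡ; zeroʳ
          ; _-_ )
  open DecTotalOrder decTotalOrder public
    using (_≟_; _≤?_)
    renaming ( refl to ≤-refl; reflexive to ≤-reflexive; trans to ≤-trans
             ; antisym to ≤-antisym; total to ≤-total )
  open NonStrictToStrict _≡_ _≤_ public
    using (_<_)

  open RawSemiringDefinitions (Semiring.rawSemiring semiring) public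
    using (_^_)
    renaming (_×_ to _·_)

  fromℕ : ℕ → ℝ
  fromℕ n = n · 1#

  UpperBound : Pred ℝ 0ℓ → Pred ℝ 0ℓ
  UpperBound P b = ∀ x → P x → x ≤ b

  IsSupremum : Pred ℝ 0ℓ → Pred ℝ 0ℓ
  IsSupremum P s = UpperBound P s × (∀ b → UpperBound P b → s ≤ b)

  field
    archimedean : ∀ x → ∃ λ n → x ≤ fromℕ n
    complete    : (P : Pred ℝ 0ℓ) → ∃ P → ∃ (UpperBound P) → ∃ (IsSupremum P)

  infixl 7 _/_
  _/_ : ℝ → ℝ → ℝ
  x / y = x * y ⁻¹

  2# : ℝ
  2# = fromℕ 2

  ∣_∣ : ℝ → ℝ
  ∣ x ∣ = if does (0# ≤? x) then x else - x

  infix 4 _<?_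
  _<?_ : ∀ x y → Dec (x < y)
  _<?_ = NonStrictToStrict.<-decidable _≡_ _≤_ _≟_ _≤?_

module OrderedFieldProperties (R : RealNumbers) where
  open RealNumbers R
  open RingProperties ring
    using (-‿involutive; -‿distribˡ-*)
  open SemiringMult semiring using (×1-homo-*)

  +-monoʳ-≤ : ∀ z {x y} → x ≤ y → z + x ≤ z + y
  +-monoʳ-≤ z {x} {y} x≤y = subst₂ _≤_ (+-comm x z) (+-comm y z) (+-monoˡ-≤ z x≤y)

  x≤x+y : ∀ x {y} → 0# ≤ y → x ≤ x + y
  x≤x+y x 0≤y = subst (_≤ x + _) (+-identityʳ x) (+-monoʳ-≤ x 0≤y)

  x≤y⇒0≤y-x : ∀ {x y} → x ≤ y → 0# ≤ y - x
  x≤y⇒0≤y-x {x} {y} x≤y = subst (_≤ y - x) (-‿inverseʳ x) (+-monoˡ-≤ (- x) x≤y)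

  y-x+x≡y : ∀ y x → (y - x) + x ≡ y
  y-x+x≡y y x = trans (+-assoc y (- x) x) (trans (cong (y +_) (-‿inverseˡ x)) (+-identityʳ y))

  0≤y-x⇒x≤y : ∀ {x y} → 0# ≤ y - x → x ≤ y
  0≤y-x⇒x≤y {x} {y} 0≤ = subst₂ _≤_ (+-identityˡ x) (y-x+x≡y y x) (+-monoˡ-≤ x 0≤)

  x≤0⇒0≤-x : ∀ {x} → x ≤ 0# → 0# ≤ - x
  x≤0⇒0≤-x {x} x≤0 = subst (0# ≤_) (+-identityˡ (- x)) (x≤y⇒0≤y-x x≤0)

  *-monoˡ-≤ : ∀ {z} → 0# ≤ z → ∀ {x y} → x ≤ y → x * z ≤ y * z
  *-monoˡ-≤ {z} 0≤z {x} {y} x≤y = 0≤y-x⇒x≤y (subst (0# ≤_) eq (*-nonNeg (x≤y⇒0≤y-x x≤y) 0≤z))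
    where
    eq : (y - x) * z ≡ y * z - x * z
    eq = trans (distribʳ z y (- x)) (cong (y * z +_) (sym (-‿distribˡ-* x z)))

  *-monoʳ-≤ : ∀ {z} → 0# ≤ z → ∀ {x y} → x ≤ y → z * x ≤ z * y
  *-monoʳ-≤ {z} 0≤z {x} {y} x≤y = subst₂ _≤_ (*-comm x z) (*-comm y z) (*-monoˡ-≤ 0≤z x≤y)

  0≤1 : 0# ≤ 1#
  0≤1 with ≤-total 0# 1#
  ... | inj₁ 0≤1 = 0≤1
  ... | inj₂ 1≤0 = subst (0# ≤_) eq (*-nonNeg (x≤0⇒0≤-x 1≤0) (x≤0⇒0≤-x 1≤0))
    where
    eq : (- 1#) * (- 1#) ≡ 1#
    eq = trans (sym (-‿distribˡ-* 1# (- 1#))) (trans (cong -_ (*-identityˡ (- 1#))) (-‿involutive 1#))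

  ≰⇒≥ : ∀ {x y} → ¬ (x ≤ y) → y ≤ x
  ≰⇒≥ {x} {y} x≰y with ≤-total x y
  ... | inj₁ x≤y = ⊥-elim (x≰y x≤y)
  ... | inj₂ y≤x = y≤x

  1≤x⇒x≢0 : ∀ {x} → 1# ≤ x → x ≢ 0#
  1≤x⇒x≢0 1≤x x≡0 = 0≢1 (≤-antisym 0≤1 (subst (1# ≤_) x≡0 1≤x))

  x≤x² : ∀ {x} → 1# ≤ x → x ≤ x * x
  x≤x² {x} 1≤x = subst (_≤ x * x) (*-identityʳ x) (*-monoʳ-≤ (≤-trans 0≤1 1≤x) 1≤x)

  fromℕ-nonNeg : ∀ n → 0# ≤ fromℕ n
  fromℕ-nonNeg zero    = ≤-refl
  fromℕ-nonNeg (suc n) = ≤-trans 0≤1 (x≤x+y 1# (fromℕ-nonNeg n))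

  fromℕ-suc≢0 : ∀ n → fromℕ (suc n) ≢ 0#
  fromℕ-suc≢0 n = 1≤x⇒x≢0 (x≤x+y 1# (fromℕ-nonNeg n))

  fromℕ-mono-+ : ∀ k n → fromℕ n ≤ fromℕ (k ℕ.+ n)
  fromℕ-mono-+ zero    n = ≤-refl
  fromℕ-mono-+ (suc k) n =
    ≤-trans (fromℕ-mono-+ k n) (subst (fromℕ (k ℕ.+ n) ≤_) (+-comm _ 1#) (x≤x+y _ 0≤1))

  fromℕ-!≢0 : ∀ n → fromℕ (n !) ≢ 0#
  fromℕ-!≢0 zero    = fromℕ-suc≢0 0
  fromℕ-!≢0 (suc n) eq = fromℕ-!≢0 n (begin
    fromℕ (n !)                                    ≡⟨ *-identityˡ _ ⟨
    1# * fromℕ (n !)                               ≡⟨ cong (_* fromℕ (n !)) (*-inverseʳ (fromℕ-suc≢0 n)) ⟨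
    fromℕ (suc n) * fromℕ (suc n) ⁻¹ * fromℕ (n !) ≡⟨ cong (_* fromℕ (n !)) (*-comm _ _) ⟩
    fromℕ (suc n) ⁻¹ * fromℕ (suc n) * fromℕ (n !) ≡⟨ *-assoc _ _ _ ⟩
    fromℕ (suc n) ⁻¹ * (fromℕ (suc n) * fromℕ (n !)) ≡⟨ cong (fromℕ (suc n) ⁻¹ *_) (×1-homo-* (suc n) (n !)) ⟨
    fromℕ (suc n) ⁻¹ * fromℕ (suc n !)             ≡⟨ cong (fromℕ (suc n) ⁻¹ *_) eq ⟩
    fromℕ (suc n) ⁻¹ * 0#                          ≡⟨ zeroʳ _ ⟩
    0#                                             ∎)
    where open ≡-Reasoning

  ⁻¹-nonNeg : ∀ {x} → x ≢ 0# → 0# ≤ x → 0# ≤ x ⁻¹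
  ⁻¹-nonNeg {x} x≢0 0≤x with ≤-total 0# (x ⁻¹)
  ... | inj₁ 0≤x⁻¹ = 0≤x⁻¹
  ... | inj₂ x⁻¹≤0 = ⊥-elim (0≢1 (≤-antisym 0≤1
          (subst₂ _≤_ (*-inverseʳ x≢0) (zeroʳ x) (*-monoʳ-≤ 0≤x x⁻¹≤0))))

  ^-nonNeg : ∀ {x} → 0# ≤ x → ∀ n → 0# ≤ x ^ n
  ^-nonNeg 0≤x zero    = 0≤1
  ^-nonNeg 0≤x (suc n) = *-nonNeg 0≤x (^-nonNeg 0≤x n)

  !⁻¹-suc : ∀ n → fromℕ (n !) ⁻¹ ≡ fromℕ (suc n) * fromℕ (suc n !) ⁻¹
  !⁻¹-suc n = begin
    v                 ≡⟨ *-identityʳ v ⟨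
    v * 1#            ≡⟨ cong (v *_) (*-inverseʳ (fromℕ-!≢0 (suc n))) ⟨
    v * (fromℕ (suc n !) * u) ≡⟨ cong (λ z → v * (z * u)) (×1-homo-* (suc n) (n !)) ⟩
    v * (c * f * u)   ≡⟨ cong (λ z → v * (z * u)) (*-comm c f) ⟩
    v * (f * c * u)   ≡⟨ cong (v *_) (*-assoc f c u) ⟩
    v * (f * (c * u)) ≡⟨ *-assoc v f (c * u) ⟨
    v * f * (c * u)   ≡⟨ cong (_* (c * u)) (trans (*-comm v f) (*-inverseʳ (fromℕ-!≢0 n))) ⟩
    1# * (c * u)      ≡⟨ *-identityˡ _ ⟩
    c * u             ∎
    where
    open ≡-Reasoning
    v = fromℕ (n !) ⁻¹
    u = fromℕ (suc n !) ⁻¹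
    c = fromℕ (suc n)
    f = fromℕ (n !)

module Analysis (R : RealNumbers) where
  open RealNumbers R
  open OrderedFieldProperties R
  open RingProperties ring using (-‿involutive; -‿+-comm)
  open CommutativeSemigroupProperties *-commutativeSemigroup
    using () renaming (x∙yz≈y∙xz to *-swap)

  -- √ a is sup { x | x² ≤ a } for a ≥ 0, and 0 otherwise.

  SquareAtMost : ℝ → Pred ℝ 0ℓ
  SquareAtMost a x = x ^ 2 ≤ a

  x^2≡x*x : ∀ x → x ^ 2 ≡ x * x
  x^2≡x*x x = cong (x *_) (*-identityʳ x)

  √-nonempty : ∀ {a} → 0# ≤ a → ∃ (SquareAtMost a)
  √-nonempty 0≤a = 0# , subst (_≤ _) (sym (zeroˡ _)) 0≤a

  √-bounded : ∀ {a} → 0# ≤ a → ∃ (UpperBound (SquareAtMost a))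
  √-bounded {a} 0≤a = 1# + a , bound
    where
    a≤1+a : a ≤ 1# + a
    a≤1+a = subst (a ≤_) (+-comm a 1#) (x≤x+y a 0≤1)
    bound : UpperBound (SquareAtMost a) (1# + a)
    bound x x²≤a with ≤-total x (1# + a)
    ... | inj₁ x≤1+a = x≤1+a
    ... | inj₂ 1+a≤x = ≤-trans (x≤x² (≤-trans (x≤x+y 1# 0≤a) 1+a≤x))
                         (≤-trans (subst (_≤ a) (x^2≡x*x x) x²≤a) a≤1+a)

  infix 9 √_
  √_ : ℝ → ℝ
  √ a with 0# ≤? a
  ... | yes 0≤a = proj₁ (complete (SquareAtMost a) (√-nonempty 0≤a) (√-bounded 0≤a))
  ... | no  _   = 0#

  -- The exponential: sup of the partial sums of Σ xᵏ/k! for x ≥ 0, extended to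
  -- x < 0 by exp x = 1 / exp (- x).

  expTerm : ℝ → ℕ → ℝ
  expTerm x k = x ^ k / fromℕ (k !)

  expSum : ℝ → ℕ → ℝ
  expSum x zero    = 0#
  expSum x (suc n) = expSum x n + expTerm x n

  ExpSums : ℝ → Pred ℝ 0ℓ
  ExpSums x y = ∃ λ n → y ≡ expSum x n

  expTerm-nonNeg : ∀ {x} → 0# ≤ x → ∀ k → 0# ≤ expTerm x k
  expTerm-nonNeg 0≤x k =
    *-nonNeg (^-nonNeg 0≤x k) (⁻¹-nonNeg (fromℕ-!≢0 k) (fromℕ-nonNeg (k !)))

  expSum-mono-+ : ∀ {x} → 0# ≤ x → ∀ k n → expSum x n ≤ expSum x (k ℕ.+ n)
  expSum-mono-+ 0≤x zero    n = ≤-refl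
  expSum-mono-+ 0≤x (suc k) n =
    ≤-trans (expSum-mono-+ 0≤x k n) (x≤x+y _ (expTerm-nonNeg 0≤x (k ℕ.+ n)))

  expTerm-halves : ∀ {x} → 0# ≤ x → ∀ n → x + x ≤ fromℕ (suc n) →
                   expTerm x (suc n) + expTerm x (suc n) ≤ expTerm x n
  expTerm-halves {x} 0≤x n 2x≤n = subst₂ _≤_ eq₁ eq₂ (*-monoˡ-≤ 0≤w 2x≤n)
    where
    open ≡-Reasoning
    u w : ℝ
    u = fromℕ (suc n !) ⁻¹
    w = x ^ n * u
    0≤w : 0# ≤ w
    0≤w = *-nonNeg (^-nonNeg 0≤x n) (⁻¹-nonNeg (fromℕ-!≢0 (suc n)) (fromℕ-nonNeg (suc n !)))
    eq₁ : (x + x) * w ≡ expTerm x (suc n) + expTerm x (suc n)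
    eq₁ = begin
      (x + x) * w                               ≡⟨ distribʳ w x x ⟩
      x * w + x * w                             ≡⟨ cong₂ _+_ (*-assoc x _ u) (*-assoc x _ u) ⟨
      expTerm x (suc n) + expTerm x (suc n)     ∎
    eq₂ : fromℕ (suc n) * w ≡ expTerm x n
    eq₂ = begin
      fromℕ (suc n) * (x ^ n * u)   ≡⟨ *-swap _ _ _ ⟩
      x ^ n * (fromℕ (suc n) * u)   ≡⟨ cong (x ^ n *_) (!⁻¹-suc n) ⟨
      expTerm x n                   ∎

  -- For n ≥ N ≥ 2x the terms at least halve, so expSum x n + 2 expTerm x n decreases.
  expSum-bounded : ∀ {x} → 0# ≤ x → ∃ (UpperBound (ExpSums x))
  expSum-bounded {x} 0≤x = T 0 , λ { _ (n , refl) → bound n }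
    where
    N : ℕ
    N = proj₁ (archimedean (x + x))
    T : ℕ → ℝ
    T k = expSum x (k ℕ.+ N) + (expTerm x (k ℕ.+ N) + expTerm x (k ℕ.+ N))
    T-step : ∀ k → T (suc k) ≤ T k
    T-step k = subst (T (suc k) ≤_) (+-assoc _ _ _)
      (+-monoʳ-≤ _ (expTerm-halves 0≤x (k ℕ.+ N)
        (≤-trans (proj₂ (archimedean (x + x))) (fromℕ-mono-+ (suc k) N))))
    T≤T0 : ∀ k → T k ≤ T 0
    T≤T0 zero    = ≤-refl
    T≤T0 (suc k) = ≤-trans (T-step k) (T≤T0 k)
    bound : ∀ n → expSum x n ≤ T 0
    bound n =
      ≤-trans (subst (λ m → expSum x n ≤ expSum x m) (ℕ.+-comm N n) (expSum-mono-+ 0≤x N n))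
      (≤-trans (x≤x+y _ (≤-trans t (x≤x+y _ t))) (T≤T0 n))
      where
      t : 0# ≤ expTerm x (n ℕ.+ N)
      t = expTerm-nonNeg 0≤x (n ℕ.+ N)

  expSup : ∀ {x} → 0# ≤ x → ∃ (IsSupremum (ExpSums x))
  expSup {x} 0≤x = complete (ExpSums x) (expSum x 0 , 0 , refl) (expSum-bounded 0≤x)

  exp : ℝ → ℝ
  exp x with 0# ≤? x
  ... | yes 0≤x = proj₁ (expSup 0≤x)
  ... | no  0≰x = proj₁ (expSup (x≤0⇒0≤-x (≰⇒≥ 0≰x))) ⁻¹

  -- log a is sup { x | exp x ≤ a } for a > 0, and 0 otherwise.

  ExpAtMost : ℝ → Pred ℝ 0ℓ
  ExpAtMost a x = exp x ≤ a

  expTerm-0 : ∀ x → expTerm x 0 ≡ 1#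
  expTerm-0 x = trans (cong (_* fromℕ 1 ⁻¹) (sym (+-identityʳ 1#))) (*-inverseʳ (fromℕ-suc≢0 0))

  expSum-0≤1 : ∀ n → expSum 0# n ≤ 1#
  expSum-0≤1 zero    = 0≤1
  expSum-0≤1 (suc n) = ≤-reflexive (eq n)
    where
    eq : ∀ n → expSum 0# (suc n) ≡ 1#
    eq zero    = trans (+-identityˡ _) (expTerm-0 0#)
    eq (suc n) = trans (cong₂ _+_ (eq n) (trans (cong (_* fromℕ (suc n !) ⁻¹) (zeroˡ _)) (zeroˡ _))) (+-identityʳ 1#)

  1+x≤expSup : ∀ {x} (0≤x : 0# ≤ x) → 1# + x ≤ proj₁ (expSup 0≤x)
  1+x≤expSup {x} 0≤x = subst (_≤ proj₁ (expSup 0≤x)) eq (proj₁ (proj₂ (expSup 0≤x)) _ (2 , refl))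
    where
    open ≡-Reasoning
    eq : expSum x 2 ≡ 1# + x
    eq = cong₂ _+_ (trans (+-identityˡ _) (expTerm-0 x)) (begin
      (x * 1#) * fromℕ 1 ⁻¹   ≡⟨ *-assoc x 1# _ ⟩
      x * expTerm x 0         ≡⟨ cong (x *_) (expTerm-0 x) ⟩
      x * 1#                  ≡⟨ *-identityʳ x ⟩
      x                       ∎)

  log-nonempty : ∀ {a} → 0# < a → ∃ (ExpAtMost a)
  log-nonempty {a} (0≤a , 0≢a) with 1# ≤? a
  ... | yes 1≤a = 0# , exp0≤a
    where
    exp0≤a : exp 0# ≤ a
    exp0≤a with 0# ≤? 0#
    ... | yes 0≤0 = proj₂ (proj₂ (expSup 0≤0)) a λ { _ (n , refl) → ≤-trans (expSum-0≤1 n) 1≤a }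
    ... | no  0≰0 = ⊥-elim (0≰0 ≤-refl)
  ... | no  1≰a = 1# - a ⁻¹ , bound
    where
    a≤1 : a ≤ 1#
    a≤1 = ≰⇒≥ 1≰a
    a≢0 : a ≢ 0#
    a≢0 a≡0 = 0≢a (sym a≡0)
    0≤a⁻¹ : 0# ≤ a ⁻¹
    0≤a⁻¹ = ⁻¹-nonNeg a≢0 0≤a
    1≤a⁻¹ : 1# ≤ a ⁻¹
    1≤a⁻¹ = subst₂ _≤_ (*-inverseʳ a≢0) (*-identityˡ _) (*-monoˡ-≤ 0≤a⁻¹ a≤1)
    eq : 1# - (1# - a ⁻¹) ≡ a ⁻¹
    eq = begin
      1# - (1# - a ⁻¹)         ≡⟨ cong (1# +_) (-‿+-comm 1# (- a ⁻¹)) ⟨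
      1# + (- 1# + - - a ⁻¹)   ≡⟨ +-assoc 1# (- 1#) _ ⟨
      (1# - 1#) + - - a ⁻¹     ≡⟨ cong₂ _+_ (-‿inverseʳ 1#) (-‿involutive (a ⁻¹)) ⟩
      0# + a ⁻¹                ≡⟨ +-identityˡ _ ⟩
      a ⁻¹                     ∎
      where open ≡-Reasoning
    bound : exp (1# - a ⁻¹) ≤ a
    bound with 0# ≤? (1# - a ⁻¹)
    ... | yes 0≤ = ⊥-elim (1≰a (subst₂ _≤_ (trans (*-comm _ _) (*-inverseʳ a≢0)) (*-identityˡ a)
                     (*-monoˡ-≤ 0≤a (0≤y-x⇒x≤y 0≤))))
    ... | no  0≰ = subst₂ _≤_ (*-identityʳ _) eq′ (*-monoʳ-≤ 0≤E⁻¹ 1≤aE)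
      where
      0≤y : 0# ≤ - (1# - a ⁻¹)
      0≤y = x≤0⇒0≤-x (≰⇒≥ 0≰)
      E : ℝ
      E = proj₁ (expSup 0≤y)
      a⁻¹≤E : a ⁻¹ ≤ E
      a⁻¹≤E = subst (_≤ E) eq (1+x≤expSup 0≤y)
      1≤E : 1# ≤ E
      1≤E = ≤-trans 1≤a⁻¹ a⁻¹≤E
      0≤E⁻¹ : 0# ≤ E ⁻¹
      0≤E⁻¹ = ⁻¹-nonNeg (1≤x⇒x≢0 1≤E) (≤-trans 0≤1 1≤E)
      1≤aE : 1# ≤ a * E
      1≤aE = subst (_≤ a * E) (*-inverseʳ a≢0) (*-monoʳ-≤ 0≤a a⁻¹≤E)
      eq′ : E ⁻¹ * (a * E) ≡ a
      eq′ = begin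
        E ⁻¹ * (a * E)   ≡⟨ *-swap _ _ _ ⟩
        a * (E ⁻¹ * E)   ≡⟨ cong (a *_) (trans (*-comm _ _) (*-inverseʳ (1≤x⇒x≢0 1≤E))) ⟩
        a * 1#           ≡⟨ *-identityʳ a ⟩
        a                ∎
        where open ≡-Reasoning

  log-bounded : ∀ {a} → 0# < a → ∃ (UpperBound (ExpAtMost a))
  log-bounded {a} (0≤a , _) = a , bound
    where
    bound : UpperBound (ExpAtMost a) a
    bound x expx≤a with 0# ≤? x
    ... | yes 0≤x = ≤-trans (subst (x ≤_) (+-comm x 1#) (x≤x+y x 0≤1))
                      (≤-trans (1+x≤expSup 0≤x) expx≤a)
    ... | no  0≰x = ≤-trans (≰⇒≥ 0≰x) 0≤a

  log : ℝ → ℝ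
  log a with 0# <? a
  ... | yes 0<a = proj₁ (complete (ExpAtMost a) (log-nonempty 0<a) (log-bounded 0<a))
  ... | no  _   = 0#

  _-ᵛ_ : ∀ {n} → Vec ℝ n → Vec ℝ n → Vec ℝ n
  _-ᵛ_ = zipWith _-_

  ‖_‖₂ : ∀ {n} → Vec ℝ n → ℝ
  ‖ v ‖₂ = √ (foldr′ _+_ 0# (map (_^ 2) v))

module RandomizedResponse (R : RealNumbers) where
  open RealNumbers R
  open Analysis R

  bit : Bool → ℝ
  bit false = 0#
  bit true  = 1#

  bits : ∀ {d} → Vec Bool d → Vec ℝ d
  bits = map bit

  -- An outcome records which bits of x and which bits of y are flipped.
  Outcome : ℕ → Set
  Outcome d = Vec Bool d × Vec Bool d

  published₁ published₂ : ∀ {d} → Vec Bool d → Outcome d → Vec Bool d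
  published₁ x (f , _) = zipWith _xor_ x f
  published₂ y (_ , g) = zipWith _xor_ y g

  flipProb : ℝ → Bool → ℝ
  flipProb p true  = p
  flipProb p false = 1# - p

  flipsProb : ℝ → ∀ {d} → Vec Bool d → ℝ
  flipsProb p f = foldr′ _*_ 1# (map (flipProb p) f)

  -- Independence of all 2d flips: the law is the product law.
  prob : ℝ → ∀ {d} → Outcome d → ℝ
  prob p (f , g) = flipsProb p f * flipsProb p g

  sumCube : ∀ d → (Vec Bool d → ℝ) → ℝ
  sumCube zero    h = h []
  sumCube (suc d) h = sumCube d (λ v → h (false ∷ v)) + sumCube d (λ v → h (true ∷ v))

  E : ℝ → ∀ {d} → (Outcome d → ℝ) → ℝ
  E p {d} X = sumCube d λ f → sumCube d λ g → prob p (f , g) * X (f , g)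

  Pr : ℝ → ∀ {d} {A : Pred (Outcome d) 0ℓ} → Decidable A → ℝ
  Pr p A? = E p λ ω → if does (A? ω) then 1# else 0#

  -- dist²_RR computed from the published vectors x̂ and ŷ.
  estimate : ℝ → ∀ {d} → Vec Bool d → Vec Bool d → ℝ
  estimate p {d} x̂ ŷ =
    (‖ bits x̂ -ᵛ bits ŷ ‖₂ ^ 2 - 2# * fromℕ d * p * (1# - p)) / (1# - 2# * p) ^ 2

  dist²RR : ℝ → ∀ {d} → Vec Bool d → Vec Bool d → Outcome d → ℝ
  dist²RR p x y ω = estimate p (published₁ x ω) (published₂ y ω)

  dist² : ∀ {d} → Vec Bool d → Vec Bool d → ℝ
  dist² x y = ‖ bits x -ᵛ bits y ‖₂ ^ 2

{-# OPTIONS --safe #-}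

-- The squared distance of the published vectors is their Hamming distance H, a sum of d
-- independent Bernoulli variables, and E[H] = 2dp(1-p) + (1-2p)² ‖x - y‖², whence the
-- estimator is unbiased.  The deviation bound is Hoeffding's inequality: Markov's inequality
-- for exp (λH) with λ = 4t/d, applied to both tails.
--
-- No calculus is available for exp, so the bound M(λ) ≤ exp (qλ + λ²/8) on the moment
-- generating function of a Bernoulli(q) variable is obtained by doubling λ: M(2λ) is at most
-- M(λ)² exp (λ²/4), so the function M(λ) exp (-qλ - λ²/8) at 2λ is at most the square of its
-- value at λ, and a crude estimate near 0 propagates to all λ.

module Submission where

open import Defs
open import Algebra.Bundles.Raw using (RawRing)
import Algebra.Properties.Ring as RingProperties
import Algebra.Properties.Semiring.Mult as SemiringMult
import Algebra.Solver.Ring as RingSolver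
import Algebra.Solver.Ring.AlmostCommutativeRing as ACR
open import Data.Bool.Base using (Bool; true; false; not; _xor_; if_then_else_)
open import Data.Empty using (⊥-elim)
open import Data.Integer.Base as ℤ using (ℤ; -[1+_]) renaming (+_ to pos)
import Data.Integer.Properties as ℤ
open import Data.Maybe.Base using (Maybe; just; nothing)
open import Data.Nat.Base as ℕ using (ℕ; zero; suc; _!)
import Data.Nat.Properties as ℕ
open import Data.Product.Base using (_×_; ∃; _,_; proj₁; proj₂)
open import Data.Sum.Base using (_⊎_; inj₁; inj₂)
open import Data.Vec.Base using (Vec; []; _∷_; map; foldr′)
open import Function.Base using (_∘_)
open import Level using (0ℓ)
open import Relation.Binary.PropositionalEquality
open import Relation.Nullary using (¬_; yes; no; does)
open import Relation.Unary using (Pred; Decidable)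

-- At negative arguments `exp` is a reciprocal rather than a supremum of partial sums. Inequalities
-- are therefore multiplied by positive exponentials until every argument is nonnegative, where the
-- addition law reduces to Cauchy products. For the same reason the lower tail uses complemented
-- bits instead of a negative λ.
--
-- The factor exp (λ²/4) bounds cosh² (λ/2), so an inequality for cosh has to come first; it is
-- itself proved by doubling. In both arguments the crude estimate carries an error whose shape the
-- doubling step reproduces: quadratic in λ where the bound is raised to the fourth power, linear
-- where it is squared. An interval of any length suffices to start, and the error parameter then
-- tends to 0 at fixed λ.
--
-- The value 4t/d minimises dλ²/8 - λt. Writing λ = 4v with v = t/d clears the denominators: dλ²/8
-- becomes 2dv².

-- Ring solver for the reals with integer coefficients.

module IntegerCoefficients (R : RealNumbers) where
  open RealNumbers R
  open RingProperties ring
    using (-‿involutive; -‿distribˡ-*; -‿distribʳ-*; -‿+-comm; -0#≈0#)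
  open SemiringMult semiring using (×1-homo-*; ×-homo-+)

  image : ℤ → ℝ
  image (pos n)    = fromℕ n
  image -[1+ n ] = - fromℕ (suc n)

  image-⊖ : ∀ m n → image (m ℤ.⊖ n) ≡ fromℕ m - fromℕ n
  image-⊖ zero    zero    = sym (-‿inverseʳ 0#)
  image-⊖ zero    (suc n) = sym (+-identityˡ _)
  image-⊖ (suc m) zero    = sym (trans (cong (fromℕ (suc m) +_) -0#≈0#) (+-identityʳ _))
  image-⊖ (suc m) (suc n) = begin
    image (suc m ℤ.⊖ suc n)                    ≡⟨ cong image (ℤ.[1+m]⊖[1+n]≡m⊖n m n) ⟩
    image (m ℤ.⊖ n)                            ≡⟨ image-⊖ m n ⟩
    a - b                                      ≡⟨ cong (_- b) (+-identityˡ a) ⟨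
    0# + a - b                                 ≡⟨ cong (λ z → z + a - b) (-‿inverseˡ 1#) ⟨
    - 1# + 1# + a - b                          ≡⟨ cong (_- b) (+-assoc _ _ _) ⟩
    - 1# + (1# + a) - b                        ≡⟨ cong (_- b) (+-comm _ _) ⟩
    1# + a - 1# - b                            ≡⟨ +-assoc _ _ _ ⟩
    1# + a + (- 1# - b)                        ≡⟨ cong (1# + a +_) (-‿+-comm 1# b) ⟩
    fromℕ (suc m) - fromℕ (suc n)              ∎
    where
    open ≡-Reasoning
    a = fromℕ m
    b = fromℕ n

  image-+ : ∀ i j → image (i ℤ.+ j) ≡ image i + image j
  image-+ (pos m)    (pos n)    = ×-homo-+ 1# m n
  image-+ (pos m)    -[1+ n ] = image-⊖ m (suc n)
  image-+ -[1+ m ] (pos n)    = trans (image-⊖ n (suc m)) (+-comm _ _)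
  image-+ -[1+ m ] -[1+ n ] = trans
    (cong -_ (trans (cong fromℕ (cong suc (sym (ℕ.+-suc m n)))) (×-homo-+ 1# (suc m) (suc n))))
    (sym (-‿+-comm _ _))

  image-neg : ∀ i → image (ℤ.- i) ≡ - image i
  image-neg (pos zero)  = sym -0#≈0#
  image-neg (pos (suc n)) = refl
  image-neg -[1+ n ]  = sym (-‿involutive _)

  image-pos-* : ∀ m j → image (pos m ℤ.* j) ≡ fromℕ m * image j
  image-pos-* m (pos n)  = trans (cong image (sym (ℤ.pos-* m n))) (×1-homo-* m n)
  image-pos-* m -[1+ n ] = begin
    image (pos m ℤ.* -[1+ n ])           ≡⟨ cong image (ℤ.neg-distribʳ-* (pos m) (pos (suc n))) ⟨
    image (ℤ.- (pos m ℤ.* pos (suc n)))  ≡⟨ image-neg (pos m ℤ.* pos (suc n)) ⟩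
    - image (pos m ℤ.* pos (suc n))      ≡⟨ cong -_ (image-pos-* m (pos (suc n))) ⟩
    - (fromℕ m * fromℕ (suc n))          ≡⟨ -‿distribʳ-* _ _ ⟩
    fromℕ m * - fromℕ (suc n)            ∎
    where open ≡-Reasoning

  image-* : ∀ i j → image (i ℤ.* j) ≡ image i * image j
  image-* (pos m)  j = image-pos-* m j
  image-* -[1+ m ] j = begin
    image (-[1+ m ] ℤ.* j)          ≡⟨ cong image (ℤ.neg-distribˡ-* (pos (suc m)) j) ⟨
    image (ℤ.- (pos (suc m) ℤ.* j)) ≡⟨ image-neg (pos (suc m) ℤ.* j) ⟩
    - image (pos (suc m) ℤ.* j)     ≡⟨ cong -_ (image-pos-* (suc m) j) ⟩
    - (fromℕ (suc m) * image j)     ≡⟨ -‿distribˡ-* _ _ ⟩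
    - fromℕ (suc m) * image j       ∎
    where open ≡-Reasoning

  -- The literal 1# must evaluate to 1# itself, not to fromℕ 1 = 1# + 0#.
  ⟦_⟧ᶻ : ℤ → ℝ
  ⟦ pos 1 ⟧ᶻ = 1#
  ⟦ i   ⟧ᶻ = image i

  ⟦⟧ᶻ≡image : ∀ i → ⟦ i ⟧ᶻ ≡ image i
  ⟦⟧ᶻ≡image (pos 0)           = refl
  ⟦⟧ᶻ≡image (pos 1)           = sym (+-identityʳ 1#)
  ⟦⟧ᶻ≡image (pos (suc (suc n))) = refl
  ⟦⟧ᶻ≡image -[1+ n ]        = refl

  ℤ-rawRing : RawRing _ _
  ℤ-rawRing = ℤ.+-*-rawRing

  -- Coefficients are integers because the solver compares normal forms by evaluation, and the
  -- equality test of the abstract reals does not compute.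
  morphism : ℤ-rawRing ACR.-Raw-AlmostCommutative⟶ ACR.fromCommutativeRing commutativeRing
  morphism = record
    { ⟦_⟧    = ⟦_⟧ᶻ
    ; +-homo = λ i j → trans (⟦⟧ᶻ≡image (i ℤ.+ j)) (trans (image-+ i j)
                 (sym (cong₂ _+_ (⟦⟧ᶻ≡image i) (⟦⟧ᶻ≡image j))))
    ; *-homo = λ i j → trans (⟦⟧ᶻ≡image (i ℤ.* j)) (trans (image-* i j)
                 (sym (cong₂ _*_ (⟦⟧ᶻ≡image i) (⟦⟧ᶻ≡image j))))
    ; -‿homo = λ i → trans (⟦⟧ᶻ≡image (ℤ.- i)) (trans (image-neg i)
                 (sym (cong -_ (⟦⟧ᶻ≡image i))))
    ; 0-homo = refl
    ; 1-homo = refl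
    }

  _coeff≟_ : ∀ i j → Maybe (⟦ i ⟧ᶻ ≡ ⟦ j ⟧ᶻ)
  i coeff≟ j with i ℤ.≟ j
  ... | yes i≡j = just (cong ⟦_⟧ᶻ i≡j)
  ... | no  _   = nothing

  open RingSolver ℤ-rawRing (ACR.fromCommutativeRing commutativeRing) morphism _coeff≟_ public
    using (solve; _:=_; _:+_; _:*_; _:-_; :-_; con; Polynomial)

  infix 10 #_
  #_ : ∀ {n} → ℕ → Polynomial n
  # k = con (pos k)

-- Order and inverses in an ordered field.

module OrderedFieldLemmas (R : RealNumbers) where
  open RealNumbers R
  open OrderedFieldProperties R
  open IntegerCoefficients R

  ≤-by : ∀ {x y} z → 0# ≤ z → y ≡ x + z → x ≤ y
  ≤-by {x} z 0≤z y≡x+z = subst (x ≤_) (sym y≡x+z) (x≤x+y x 0≤z)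

  +-mono-≤ : ∀ {w x y z} → w ≤ x → y ≤ z → w + y ≤ x + z
  +-mono-≤ {x = x} {y} w≤x y≤z = ≤-trans (+-monoˡ-≤ y w≤x) (+-monoʳ-≤ x y≤z)

  *-mono-≤ : ∀ {w x y z} → 0# ≤ w → 0# ≤ z → w ≤ x → y ≤ z → w * y ≤ x * z
  *-mono-≤ 0≤w 0≤z w≤x y≤z = ≤-trans (*-monoʳ-≤ 0≤w y≤z) (*-monoˡ-≤ 0≤z w≤x)

  +-nonNeg : ∀ {x y} → 0# ≤ x → 0# ≤ y → 0# ≤ x + y
  +-nonNeg 0≤x 0≤y = ≤-trans 0≤x (x≤x+y _ 0≤y)

  x*x-nonNeg : ∀ x → 0# ≤ x * x
  x*x-nonNeg x with ≤-total 0# x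
  ... | inj₁ 0≤x = *-nonNeg 0≤x 0≤x
  ... | inj₂ x≤0 = subst (0# ≤_) (solve 1 (λ x → (:- x) :* (:- x) := x :* x) refl x)
                     (*-nonNeg (x≤0⇒0≤-x x≤0) (x≤0⇒0≤-x x≤0))

  ≰⇒> : ∀ {x y} → ¬ (x ≤ y) → y < x
  ≰⇒> x≰y = ≰⇒≥ x≰y , λ y≡x → x≰y (≤-reflexive (sym y≡x))

  ≮⇒≥ : ∀ {x y} → ¬ (x < y) → y ≤ x
  ≮⇒≥ {x} {y} x≮y with y ≤? x
  ... | yes y≤x = y≤x
  ... | no  y≰x = ⊥-elim (x≮y (≰⇒> y≰x))

  <⇒≱ : ∀ {x y} → x < y → ¬ (y ≤ x)
  <⇒≱ (x≤y , x≢y) y≤x = x≢y (≤-antisym x≤y y≤x)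

  <-≤-trans : ∀ {x y z} → x < y → y ≤ z → x < z
  <-≤-trans x<y y≤z = ≤-trans (proj₁ x<y) y≤z , λ { refl → <⇒≱ x<y y≤z }

  ≤-<-trans : ∀ {x y z} → x ≤ y → y < z → x < z
  ≤-<-trans x≤y y<z = ≤-trans x≤y (proj₁ y<z) , λ { refl → <⇒≱ y<z x≤y }

  x+z≤x⇒z≤0 : ∀ {x z} → x + z ≤ x → z ≤ 0#
  x+z≤x⇒z≤0 {x} {z} le = subst₂ _≤_ (solve 2 (λ x z → x :+ z :- x := z) refl x z) (-‿inverseʳ x)
    (+-monoˡ-≤ (- x) le)

  <-by : ∀ {x y} z → 0# < z → y ≡ x + z → x < y
  <-by {x} z 0<z y≡x+z = ≤-by z (proj₁ 0<z) y≡x+z ,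
    λ x≡y → <⇒≱ 0<z (x+z≤x⇒z≤0 (≤-reflexive (trans (sym y≡x+z) (sym x≡y))))

  >⇒≢ : ∀ {x} → 0# < x → x ≢ 0#
  >⇒≢ (_ , 0≢x) x≡0 = 0≢x (sym x≡0)

  0<1 : 0# < 1#
  0<1 = 0≤1 , 0≢1

  0<fromℕ-suc : ∀ n → 0# < fromℕ (suc n)
  0<fromℕ-suc n = <-≤-trans 0<1 (x≤x+y 1# (fromℕ-nonNeg n))

  x<y⇒0<y-x : ∀ {x y} → x < y → 0# < y - x
  x<y⇒0<y-x {x} {y} (x≤y , x≢y) = x≤y⇒0≤y-x x≤y ,
    λ 0≡y-x → x≢y (trans (sym (+-identityˡ x)) (trans (cong (_+ x) 0≡y-x) (y-x+x≡y y x)))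

  *-inverseˡ : ∀ {x} → x ≢ 0# → x ⁻¹ * x ≡ 1#
  *-inverseˡ x≢0 = trans (*-comm _ _) (*-inverseʳ x≢0)

  ⁻¹-pos : ∀ {x} → 0# < x → 0# < x ⁻¹
  ⁻¹-pos {x} 0<x = ⁻¹-nonNeg (>⇒≢ 0<x) (proj₁ 0<x) ,
    λ 0≡x⁻¹ → 0≢1 (trans (sym (zeroʳ x)) (trans (cong (x *_) 0≡x⁻¹) (*-inverseʳ (>⇒≢ 0<x))))

  x*[x⁻¹*y]≡y : ∀ {x} → x ≢ 0# → ∀ y → x * (x ⁻¹ * y) ≡ y
  x*[x⁻¹*y]≡y x≢0 y = trans (sym (*-assoc _ _ y)) (trans (cong (_* y) (*-inverseʳ x≢0)) (*-identityˡ y))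

  x⁻¹*[x*y]≡y : ∀ {x} → x ≢ 0# → ∀ y → x ⁻¹ * (x * y) ≡ y
  x⁻¹*[x*y]≡y x≢0 y = trans (sym (*-assoc _ _ y)) (trans (cong (_* y) (*-inverseˡ x≢0)) (*-identityˡ y))

  *-cancelˡ-≡ : ∀ {z} → z ≢ 0# → ∀ {x y} → z * x ≡ z * y → x ≡ y
  *-cancelˡ-≡ {z} z≢0 {x} {y} eq =
    trans (sym (x⁻¹*[x*y]≡y z≢0 x)) (trans (cong (z ⁻¹ *_) eq) (x⁻¹*[x*y]≡y z≢0 y))

  *-cancelˡ-≤ : ∀ {z} → 0# < z → ∀ {x y} → z * x ≤ z * y → x ≤ y
  *-cancelˡ-≤ {z} 0<z {x} {y} le =
    subst₂ _≤_ (x⁻¹*[x*y]≡y (>⇒≢ 0<z) x) (x⁻¹*[x*y]≡y (>⇒≢ 0<z) y)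
      (*-monoʳ-≤ (proj₁ (⁻¹-pos 0<z)) le)

  *-pos : ∀ {x y} → 0# < x → 0# < y → 0# < x * y
  *-pos {x} {y} 0<x 0<y = *-nonNeg (proj₁ 0<x) (proj₁ 0<y) ,
    λ 0≡xy → proj₂ 0<y (*-cancelˡ-≡ (>⇒≢ 0<x) (trans (zeroʳ x) 0≡xy))

  -- For `c` nonzero, `c ⁻¹ * e` is an upper bound of `P`. At `c = 0#` there is nothing to divide
  -- by, and `0# ≤ e` is the claim itself. This is the tool for passing products of partial sums to
  -- the limit.
  sup-*ʳ : ∀ {P s c e} → IsSupremum P s → 0# ≤ c → 0# ≤ e → (∀ x → P x → x * c ≤ e) → s * c ≤ e
  sup-*ʳ {P} {s} {c} {e} (_ , least) 0≤c 0≤e xc≤e with c ≟ 0#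
  ... | yes refl = subst (_≤ e) (sym (zeroʳ s)) 0≤e
  ... | no c≢0 = subst₂ _≤_ (*-comm c s) (x*[x⁻¹*y]≡y c≢0 e) (*-monoʳ-≤ 0≤c
          (least (c ⁻¹ * e) λ x Px → *-cancelˡ-≤ (0≤c , λ 0≡c → c≢0 (sym 0≡c))
            (subst₂ _≤_ (*-comm x c) (sym (x*[x⁻¹*y]≡y c≢0 e)) (xc≤e x Px))))

-- The supremum defining the square root squares to its argument.

module SquareRoot (R : RealNumbers) where
  open RealNumbers R
  open OrderedFieldProperties R
  open OrderedFieldLemmas R
  open Analysis R
  open IntegerCoefficients R

  √-isSupremum : ∀ {a} → 0# ≤ a → IsSupremum (SquareAtMost a) (√ a)
  √-isSupremum {a} 0≤a with 0# ≤? a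
  ... | yes 0≤a′ = proj₂ (complete (SquareAtMost a) (√-nonempty 0≤a′) (√-bounded 0≤a′))
  ... | no 0≰a   = ⊥-elim (0≰a 0≤a)

  √-nonNeg : ∀ {a} → 0# ≤ a → 0# ≤ √ a
  √-nonNeg 0≤a = proj₁ (√-isSupremum 0≤a) 0# (proj₂ (√-nonempty 0≤a))

  -- AM–GM: 2 s x ≤ s² + x² ≤ s² + a bounds every x with x² ≤ a.
  √-square-≤ : ∀ {a} → 0# ≤ a → √ a * √ a ≤ a
  √-square-≤ {a} 0≤a with √ a ≟ 0#
  ... | yes s≡0 = subst (_≤ a) (sym (trans (cong₂ _*_ s≡0 s≡0) (zeroˡ 0#))) 0≤a
  ... | no  s≢0 = ≤-by (b - s * (s + s)) (x≤y⇒0≤y-x 2ss≤b)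
                    (solve 2 (λ s a → a := s :* s :+ (s :* s :+ a :- s :* (s :+ s))) refl s a)
    where
    s b c : ℝ
    s = √ a
    b = s * s + a
    c = s + s
    0<s : 0# < s
    0<s = √-nonNeg 0≤a , λ 0≡s → s≢0 (sym 0≡s)
    0<c : 0# < c
    0<c = <-≤-trans 0<s (x≤x+y s (proj₁ 0<s))
    bound : UpperBound (SquareAtMost a) (c ⁻¹ * b)
    bound x x²≤a = *-cancelˡ-≤ 0<c (subst (c * x ≤_) (sym (x*[x⁻¹*y]≡y (>⇒≢ 0<c) b))
      (≤-trans
        (≤-by ((s - x) * (s - x)) (x*x-nonNeg (s - x))
          (solve 2 (λ s x → s :* s :+ x :* x := (s :+ s) :* x :+ (s :- x) :* (s :- x)) refl s x))
        (+-monoʳ-≤ (s * s) (subst (_≤ a) (x^2≡x*x x) x²≤a))))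
    2ss≤b : s * c ≤ b
    2ss≤b = subst₂ _≤_ (*-comm c s) (x*[x⁻¹*y]≡y (>⇒≢ 0<c) b)
      (*-monoʳ-≤ (proj₁ 0<c) (proj₂ (√-isSupremum 0≤a) _ bound))

  -- If the square of the supremum fell short of `a`, a slightly larger number would still have
  -- square at most `a`.
  √-square-≥ : ∀ {a} → 0# ≤ a → a ≤ √ a * √ a
  √-square-≥ {a} 0≤a with a ≤? √ a * √ a
  ... | yes a≤ss = a≤ss
  ... | no  a≰ss = ⊥-elim (<⇒≱ 0<ε (x+z≤x⇒z≤0 {s} {ε} (proj₁ (√-isSupremum 0≤a) (s + ε) [s+ε]²≤a)))
    where
    s D c ε : ℝ
    s = √ a
    D = a - s * s
    -- The summand `D` forces `ε ≤ 1#`, hence ε² ≤ ε, and the summands `s + s + 1#` then cover the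
    -- growth 2sε + ε² of the square.
    c = s + s + 1# + D
    ε = c ⁻¹ * D
    0≤s : 0# ≤ s
    0≤s = √-nonNeg 0≤a
    0<D : 0# < D
    0<D = x<y⇒0<y-x (≰⇒> a≰ss)
    D≤c : D ≤ c
    D≤c = ≤-by (s + s + 1#) (+-nonNeg (+-nonNeg 0≤s 0≤s) 0≤1) (+-comm _ _)
    0<c : 0# < c
    0<c = <-≤-trans 0<D D≤c
    0<ε : 0# < ε
    0<ε = *-pos (⁻¹-pos 0<c) 0<D
    cε≡D : c * ε ≡ D
    cε≡D = x*[x⁻¹*y]≡y (>⇒≢ 0<c) D
    ε≤1 : ε ≤ 1#
    ε≤1 = *-cancelˡ-≤ 0<c (subst₂ _≤_ (sym cε≡D) (sym (*-identityʳ c)) D≤c)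
    [s+ε]²≤a : (s + ε) ^ 2 ≤ a
    [s+ε]²≤a = subst (_≤ a) (sym (x^2≡x*x (s + ε)))
      (≤-by (ε * (1# - ε + D)) (*-nonNeg (proj₁ 0<ε) (+-nonNeg (x≤y⇒0≤y-x ε≤1) (proj₁ 0<D)))
        (begin
          a                                       ≡⟨ solve 2 (λ a ss → a := ss :+ (a :- ss)) refl a (s * s) ⟩
          s * s + D                               ≡⟨ cong (s * s +_) cε≡D ⟨
          s * s + c * ε                           ≡⟨ solve 3 (λ s ε D → s :* s :+ (s :+ s :+ # 1 :+ D) :* ε
                                                       := (s :+ ε) :* (s :+ ε) :+ ε :* (# 1 :- ε :+ D)) refl s ε D ⟩
          (s + ε) * (s + ε) + ε * (1# - ε + D)    ∎))
      where open ≡-Reasoning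

  √-square : ∀ {a} → 0# ≤ a → √ a * √ a ≡ a
  √-square 0≤a = ≤-antisym (√-square-≤ 0≤a) (√-square-≥ 0≤a)

-- Formal power series: convolution, product rule, partial sums.

module CauchyProduct (R : RealNumbers) where
  open RealNumbers R
  open OrderedFieldProperties R
  open OrderedFieldLemmas R
  open IntegerCoefficients R

  Sequence : Set
  Sequence = ℕ → ℝ

  shift : Sequence → Sequence
  shift a k = a (suc k)

  derivative : Sequence → Sequence
  derivative a k = fromℕ (suc k) * a (suc k)

  ∑ : Sequence → ℕ → ℝ
  ∑ a zero    = 0#
  ∑ a (suc n) = ∑ a n + a n

  infixl 7 _∗_
  -- The coefficients Σ aₖ bₙ₋ₖ of a product of power series, unrolled along the first factor so
  -- that no index is ever subtracted.
  _∗_ : Sequence → Sequence → Sequence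
  (a ∗ b) zero    = a zero * b zero
  (a ∗ b) (suc n) = a zero * b (suc n) + (shift a ∗ b) n

  ∗-congˡ : ∀ {a a′} b → (∀ k → a k ≡ a′ k) → ∀ n → (a ∗ b) n ≡ (a′ ∗ b) n
  ∗-congˡ b eq zero    = cong (_* b zero) (eq zero)
  ∗-congˡ b eq (suc n) = cong₂ _+_ (cong (_* b (suc n)) (eq zero)) (∗-congˡ b (λ k → eq (suc k)) n)

  ∗-congʳ : ∀ a {b b′} → (∀ k → b k ≡ b′ k) → ∀ n → (a ∗ b) n ≡ (a ∗ b′) n
  ∗-congʳ a eq zero    = cong (a zero *_) (eq zero)
  ∗-congʳ a eq (suc n) = cong₂ _+_ (cong (a zero *_) (eq (suc n))) (∗-congʳ (shift a) eq n)

  ∗-distribʳ-+ : ∀ a a′ b n → ((λ k → a k + a′ k) ∗ b) n ≡ (a ∗ b) n + (a′ ∗ b) n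
  ∗-distribʳ-+ a a′ b zero    = distribʳ _ _ _
  ∗-distribʳ-+ a a′ b (suc n) =
    trans (cong ((a zero + a′ zero) * b (suc n) +_) (∗-distribʳ-+ (shift a) (shift a′) b n))
      (solve 5 (λ a a′ b c c′ → (a :+ a′) :* b :+ (c :+ c′) := a :* b :+ c :+ (a′ :* b :+ c′)) refl
        (a zero) (a′ zero) (b (suc n)) _ _)

  ∗-scaleˡ : ∀ c a b n → ((λ k → c * a k) ∗ b) n ≡ c * (a ∗ b) n
  ∗-scaleˡ c a b zero    = *-assoc c _ _
  ∗-scaleˡ c a b (suc n) = trans (cong₂ _+_ (*-assoc c _ _) (∗-scaleˡ c (shift a) b n)) (sym (distribˡ c _ _))

  ∗-scaleʳ : ∀ c a b n → (a ∗ (λ k → c * b k)) n ≡ c * (a ∗ b) n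
  ∗-scaleʳ c a b zero    = solve 3 (λ c a b → a :* (c :* b) := c :* (a :* b)) refl c (a zero) (b zero)
  ∗-scaleʳ c a b (suc n) = trans (cong (a zero * (c * b (suc n)) +_) (∗-scaleʳ c (shift a) b n))
    (solve 4 (λ c a b r → a :* (c :* b) :+ c :* r := c :* (a :* b :+ r)) refl c (a zero) (b (suc n)) _)

  -- The product rule for formal power series. It lets a convolution of exponential series be
  -- identified by its differential equation, without binomial coefficients.
  leibniz : ∀ a b n → derivative (a ∗ b) n ≡ (derivative a ∗ b) n + (a ∗ derivative b) n
  leibniz a b zero = solve 4 (λ a₀ a₁ b₀ b₁ →
      (# 1 :+ # 0) :* (a₀ :* b₁ :+ a₁ :* b₀) := (# 1 :+ # 0) :* a₁ :* b₀ :+ a₀ :* ((# 1 :+ # 0) :* b₁)) refl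
    (a 0) (a 1) (b 0) (b 1)
  leibniz a b (suc n) = begin
    (1# + N) * (a₀ * b₂ + C)
      ≡⟨ solve 4 (λ N a₀ b₂ C → (# 1 :+ N) :* (a₀ :* b₂ :+ C) := (# 1 :+ N) :* (a₀ :* b₂) :+ C :+ N :* C) refl N a₀ b₂ C ⟩
    (1# + N) * (a₀ * b₂) + C + N * C
      ≡⟨ cong ((1# + N) * (a₀ * b₂) + C +_) (leibniz (shift a) b n) ⟩
    (1# + N) * (a₀ * b₂) + (a₁ * b₁ + S) + (P + Q)
      ≡⟨ solve 8 (λ N a₀ a₁ b₁ b₂ S P Q → (# 1 :+ N) :* (a₀ :* b₂) :+ (a₁ :* b₁ :+ S) :+ (P :+ Q)
           := (# 1 :+ # 0) :* a₁ :* b₁ :+ (S :+ P) :+ (a₀ :* ((# 1 :+ N) :* b₂) :+ Q)) refl N a₀ a₁ b₁ b₂ S P Q ⟩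
    (1# + 0#) * a₁ * b₁ + (S + P) + (a₀ * ((1# + N) * b₂) + Q)
      ≡⟨ cong (λ z → (1# + 0#) * a₁ * b₁ + z + (a₀ * ((1# + N) * b₂) + Q)) shifted ⟨
    (derivative a ∗ b) (suc n) + (a ∗ derivative b) (suc n)
      ∎
    where
    open ≡-Reasoning
    N a₀ a₁ b₁ b₂ C S P Q : ℝ
    N = fromℕ (suc n)
    a₀ = a 0
    a₁ = a 1
    b₁ = b (suc n)
    b₂ = b (suc (suc n))
    C = (shift a ∗ b) (suc n)
    S = (shift (shift a) ∗ b) n
    P = (derivative (shift a) ∗ b) n
    Q = (shift a ∗ derivative b) n
    -- Shift and derivative commute up to one term: (k+2) aₖ₊₂ = aₖ₊₂ + (k+1) aₖ₊₂. The extra term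
    -- supplies the `S` in the surplus copy of `C`.
    shifted : (shift (derivative a) ∗ b) n ≡ S + P
    shifted = trans
      (∗-congˡ b (λ k → trans (distribʳ _ _ _) (cong (_+ derivative (shift a) k) (*-identityˡ _))) n)
      (∗-distribʳ-+ (shift (shift a)) (derivative (shift a)) b n)

  ∑-shift : ∀ a n → ∑ a (suc n) ≡ a 0 + ∑ (shift a) n
  ∑-shift a zero    = +-comm _ _
  ∑-shift a (suc n) = trans (cong (_+ a (suc n)) (∑-shift a n)) (+-assoc _ _ _)

  ∑-∗ : ∀ a b n → ∑ (a ∗ b) (suc n) ≡ a 0 * ∑ b (suc n) + ∑ (shift a ∗ b) n
  ∑-∗ a b zero    = solve 2 (λ a b → # 0 :+ a :* b := a :* (# 0 :+ b) :+ # 0) refl (a 0) (b 0)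
  ∑-∗ a b (suc n) = trans (cong (_+ (a ∗ b) (suc n)) (∑-∗ a b n))
    (solve 5 (λ a s t b c → a :* s :+ t :+ (a :* b :+ c) := a :* (s :+ b) :+ (t :+ c)) refl
      (a 0) (∑ b (suc n)) (∑ (shift a ∗ b) n) (b (suc n)) ((shift a ∗ b) n))

  ∑-nonNeg : ∀ {a} → (∀ k → 0# ≤ a k) → ∀ n → 0# ≤ ∑ a n
  ∑-nonNeg 0≤a zero    = ≤-refl
  ∑-nonNeg 0≤a (suc n) = +-nonNeg (∑-nonNeg 0≤a n) (0≤a n)

  ∑-mono-+ : ∀ {a} → (∀ k → 0# ≤ a k) → ∀ m n → ∑ a n ≤ ∑ a (m ℕ.+ n)
  ∑-mono-+ 0≤a zero    n = ≤-refl
  ∑-mono-+ 0≤a (suc m) n = ≤-trans (∑-mono-+ 0≤a m n) (x≤x+y _ (0≤a (m ℕ.+ n)))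

  -- The triangle i + j < n of index pairs lies in the square i, j < n.
  ∑-∗-≤ : ∀ {a b} → (∀ k → 0# ≤ a k) → (∀ k → 0# ≤ b k) → ∀ n → ∑ (a ∗ b) n ≤ ∑ a n * ∑ b n
  ∑-∗-≤ 0≤a 0≤b zero = ≤-reflexive (sym (zeroˡ 0#))
  ∑-∗-≤ {a} {b} 0≤a 0≤b (suc n) =
    subst₂ _≤_ (sym (∑-∗ a b n)) (trans (sym (distribʳ _ _ _)) (cong (_* ∑ b (suc n)) (sym (∑-shift a n))))
      (+-monoʳ-≤ _ (≤-trans (∑-∗-≤ (λ k → 0≤a (suc k)) 0≤b n)
        (*-monoʳ-≤ (∑-nonNeg (λ k → 0≤a (suc k)) n) (x≤x+y _ (0≤b n)))))

  -- The rectangle i < m, j < n of index pairs lies in the triangle i + j < m + n.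
  ∑-∗-≥ : ∀ {a b} → (∀ k → 0# ≤ a k) → (∀ k → 0# ≤ b k) → ∀ m n → ∑ a m * ∑ b n ≤ ∑ (a ∗ b) (m ℕ.+ n)
  ∑-∗-≥ {a} {b} 0≤a 0≤b zero n = subst (_≤ ∑ (a ∗ b) n) (sym (zeroˡ _)) (∑-nonNeg (0≤∗ 0≤a) n)
    where
    0≤∗ : ∀ {a} → (∀ k → 0# ≤ a k) → ∀ k → 0# ≤ (a ∗ b) k
    0≤∗ 0≤a zero    = *-nonNeg (0≤a 0) (0≤b 0)
    0≤∗ 0≤a (suc k) = +-nonNeg (*-nonNeg (0≤a 0) (0≤b (suc k))) (0≤∗ (λ k → 0≤a (suc k)) k)
  ∑-∗-≥ {a} {b} 0≤a 0≤b (suc m) n =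
    subst₂ _≤_ (trans (sym (distribʳ _ _ _)) (cong (_* ∑ b n) (sym (∑-shift a m)))) (sym (∑-∗ a b (m ℕ.+ n)))
      (+-mono-≤ (*-monoʳ-≤ (0≤a 0) (∑-mono-+ 0≤b (suc m) n)) (∑-∗-≥ (λ k → 0≤a (suc k)) 0≤b m n))

-- The exponential on nonnegative reals and the logarithm above 1.

module Exponential (R : RealNumbers) where
  open RealNumbers R
  open OrderedFieldProperties R
  open OrderedFieldLemmas R
  open Analysis R
  open CauchyProduct R
  open IntegerCoefficients R

  exp-isSupremum : ∀ {x} → 0# ≤ x → IsSupremum (ExpSums x) (exp x)
  exp-isSupremum {x} 0≤x with 0# ≤? x
  ... | yes 0≤x′ = proj₂ (expSup 0≤x′)
  ... | no  0≰x  = ⊥-elim (0≰x 0≤x)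

  expSum≤exp : ∀ {x} → 0# ≤ x → ∀ n → expSum x n ≤ exp x
  expSum≤exp 0≤x n = proj₁ (exp-isSupremum 0≤x) _ (n , refl)

  exp-least : ∀ {x b} → 0# ≤ x → (∀ n → expSum x n ≤ b) → exp x ≤ b
  exp-least 0≤x bound = proj₂ (exp-isSupremum 0≤x) _ λ { _ (n , refl) → bound n }

  expTerm-suc : ∀ x n → derivative (expTerm x) n ≡ x * expTerm x n
  expTerm-suc x n = begin
    c * (x * x ^ n * u)                   ≡⟨ solve 4 (λ c x p u → c :* (x :* p :* u) := x :* (p :* (c :* u))) refl c x (x ^ n) u ⟩
    x * (x ^ n * (c * u))                 ≡⟨ cong (λ z → x * (x ^ n * z)) (!⁻¹-suc n) ⟨
    x * expTerm x n                       ∎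
    where
    open ≡-Reasoning
    c u : ℝ
    c = fromℕ (suc n)
    u = fromℕ (suc n !) ⁻¹

  expSum≡∑ : ∀ x n → expSum x n ≡ ∑ (expTerm x) n
  expSum≡∑ x zero    = refl
  expSum≡∑ x (suc n) = cong (_+ expTerm x n) (expSum≡∑ x n)

  -- Both sides satisfy c₀ = 1 and (n + 1) cₙ₊₁ = (x + y) cₙ.
  expTerm-+ : ∀ x y n → expTerm (x + y) n ≡ (expTerm x ∗ expTerm y) n
  expTerm-+ x y zero = trans (expTerm-0 (x + y))
    (sym (trans (cong₂ _*_ (expTerm-0 x) (expTerm-0 y)) (*-identityʳ 1#)))
  expTerm-+ x y (suc n) = *-cancelˡ-≡ (fromℕ-suc≢0 n) (begin
    derivative (expTerm (x + y)) n                    ≡⟨ expTerm-suc (x + y) n ⟩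
    (x + y) * expTerm (x + y) n                       ≡⟨ cong ((x + y) *_) (expTerm-+ x y n) ⟩
    (x + y) * (a ∗ b) n                               ≡⟨ distribʳ _ x y ⟩
    x * (a ∗ b) n + y * (a ∗ b) n                     ≡⟨ cong₂ _+_ (∗-scaleˡ x a b n) (∗-scaleʳ y a b n) ⟨
    ((λ k → x * a k) ∗ b) n + (a ∗ (λ k → y * b k)) n ≡⟨ cong₂ _+_ (∗-congˡ b (expTerm-suc x) n) (∗-congʳ a (expTerm-suc y) n) ⟨
    (derivative a ∗ b) n + (a ∗ derivative b) n       ≡⟨ leibniz a b n ⟨
    derivative (a ∗ b) n                              ∎)
    where
    open ≡-Reasoning
    a b : Sequence
    a = expTerm x
    b = expTerm y

  expSum-+ : ∀ x y n → expSum (x + y) n ≡ ∑ (expTerm x ∗ expTerm y) n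
  expSum-+ x y zero    = refl
  expSum-+ x y (suc n) = cong₂ _+_ (expSum-+ x y n) (expTerm-+ x y n)

  1+x≤exp : ∀ {x} → 0# ≤ x → 1# + x ≤ exp x
  1+x≤exp {x} 0≤x with 0# ≤? x
  ... | yes 0≤x′ = 1+x≤expSup 0≤x′
  ... | no  0≰x  = ⊥-elim (0≰x 0≤x)

  1≤exp : ∀ {x} → 0# ≤ x → 1# ≤ exp x
  1≤exp 0≤x = ≤-trans (x≤x+y 1# 0≤x) (1+x≤exp 0≤x)

  0<exp : ∀ {x} → 0# ≤ x → 0# < exp x
  0<exp 0≤x = <-≤-trans 0<1 (1≤exp 0≤x)

  0≤exp : ∀ {x} → 0# ≤ x → 0# ≤ exp x
  0≤exp 0≤x = proj₁ (0<exp 0≤x)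

  -- Partial sums of the product series are squeezed between products of partial sums. In `above`
  -- the two suprema are taken one after the other, each with the other factor held fixed.
  exp-+ : ∀ {x y} → 0# ≤ x → 0# ≤ y → exp (x + y) ≡ exp x * exp y
  exp-+ {x} {y} 0≤x 0≤y = ≤-antisym below above
    where
    0≤x+y : 0# ≤ x + y
    0≤x+y = +-nonNeg 0≤x 0≤y
    below : exp (x + y) ≤ exp x * exp y
    below = exp-least 0≤x+y λ n → ≤-trans
      (subst (_≤ ∑ (expTerm x) n * ∑ (expTerm y) n) (sym (expSum-+ x y n))
        (∑-∗-≤ (expTerm-nonNeg 0≤x) (expTerm-nonNeg 0≤y) n))
      (*-mono-≤ (∑-nonNeg (expTerm-nonNeg 0≤x) n) (0≤exp 0≤y)
        (subst (_≤ exp x) (expSum≡∑ x n) (expSum≤exp 0≤x n))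
        (subst (_≤ exp y) (expSum≡∑ y n) (expSum≤exp 0≤y n)))
    product : ∀ m n → expSum x m * expSum y n ≤ exp (x + y)
    product m n = ≤-trans
      (subst₂ _≤_ (sym (cong₂ _*_ (expSum≡∑ x m) (expSum≡∑ y n))) (sym (expSum-+ x y (m ℕ.+ n)))
        (∑-∗-≥ (expTerm-nonNeg 0≤x) (expTerm-nonNeg 0≤y) m n))
      (expSum≤exp 0≤x+y (m ℕ.+ n))
    half : ∀ n → exp x * expSum y n ≤ exp (x + y)
    half n = sup-*ʳ (exp-isSupremum 0≤x)
      (subst (0# ≤_) (sym (expSum≡∑ y n)) (∑-nonNeg (expTerm-nonNeg 0≤y) n)) (0≤exp 0≤x+y)
      λ { _ (m , refl) → product m n }
    above : exp x * exp y ≤ exp (x + y)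
    above = subst (_≤ exp (x + y)) (*-comm _ _) (sup-*ʳ (exp-isSupremum 0≤y) (0≤exp 0≤x) (0≤exp 0≤x+y)
      λ { _ (n , refl) → subst (_≤ exp (x + y)) (*-comm _ _) (half n) })

  exp-mono-≤ : ∀ {x y} → 0# ≤ x → x ≤ y → exp x ≤ exp y
  exp-mono-≤ {x} {y} 0≤x x≤y = subst₂ _≤_ (*-identityʳ _)
    (trans (sym (exp-+ 0≤x (x≤y⇒0≤y-x x≤y))) (cong exp (solve 2 (λ x y → x :+ (y :- x) := y) refl x y)))
    (*-monoʳ-≤ (0≤exp 0≤x) (1≤exp (x≤y⇒0≤y-x x≤y)))

  -- The Padé bound eˣ ≤ (2 + x)/(2 - x): after the n-th term the series is dominated by a
  -- geometric one of ratio x/2.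
  [2-x]*exp≤2+x : ∀ {x} → 0# ≤ x → x ≤ 2# → (2# - x) * exp x ≤ 2# + x
  [2-x]*exp≤2+x {x} 0≤x x≤2 =
    subst (_≤ 2# + x) (*-comm _ _) (sup-*ʳ (exp-isSupremum 0≤x) 0≤2-x (+-nonNeg (fromℕ-nonNeg 2) 0≤x)
      λ { _ (n , refl) → subst (_≤ 2# + x) (*-comm _ _) (≤-trans
            (*-monoʳ-≤ 0≤2-x (expSum-mono-+ 0≤x 2 n))
            (≤-trans (x≤x+y _ (*-nonNeg 0≤x (expTerm-nonNeg 0≤x (suc n)))) (tail n))) })
    where
    0≤2-x : 0# ≤ 2# - x
    0≤2-x = x≤y⇒0≤y-x x≤2
    expTerm-1 : expTerm x 1 ≡ x
    expTerm-1 = begin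
      x * 1# * fromℕ 1 ⁻¹    ≡⟨ *-assoc x _ _ ⟩
      x * expTerm x 0        ≡⟨ cong (x *_) (expTerm-0 x) ⟩
      x * 1#                 ≡⟨ *-identityʳ x ⟩
      x                      ∎
      where open ≡-Reasoning
    tail : ∀ n → (2# - x) * expSum x (2 ℕ.+ n) + x * expTerm x (suc n) ≤ 2# + x
    tail zero = ≤-reflexive (trans
      (cong₂ (λ s t → (2# - x) * (0# + s + t) + x * t) (expTerm-0 x) expTerm-1)
      (solve 1 (λ x → (# 2 :- x) :* (# 0 :+ # 1 :+ x) :+ x :* x := # 2 :+ x) refl x))
    -- The recurrence gives x t₁ = (n+2) t₂. Of this, 2 t₂ = (2-x) t₂ + x t₂ pays for the new
    -- summand and the new remainder, and n t₂ is left over.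
    tail (suc n) = ≤-trans (≤-by (fromℕ n * t₂)
      (*-nonNeg (fromℕ-nonNeg n) (expTerm-nonNeg 0≤x (2 ℕ.+ n)))
      (begin
        (2# - x) * s + x * t₁                                  ≡⟨ cong ((2# - x) * s +_) (expTerm-suc x (suc n)) ⟨
        (2# - x) * s + (1# + (1# + fromℕ n)) * t₂              ≡⟨ solve 4 (λ x s n t → (# 2 :- x) :* s :+ (# 1 :+ (# 1 :+ n)) :* t
                                                                    := (# 2 :- x) :* (s :+ t) :+ x :* t :+ n :* t) refl x s (fromℕ n) t₂ ⟩
        (2# - x) * (s + t₂) + x * t₂ + fromℕ n * t₂            ∎))
      (tail n)
      where
      open ≡-Reasoning
      s t₁ t₂ : ℝ
      s = expSum x (2 ℕ.+ n)
      t₁ = expTerm x (suc n)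
      t₂ = expTerm x (2 ℕ.+ n)

  -- A polynomial form of the Padé bound: (2-x)(1+x+x²) exceeds 2+x by x²(1-x).
  exp≤1+x+x² : ∀ {x} → 0# ≤ x → x ≤ 1# → exp x ≤ 1# + x + x * x
  exp≤1+x+x² {x} 0≤x x≤1 = *-cancelˡ-≤ 0<2-x (≤-trans ([2-x]*exp≤2+x 0≤x x≤2)
    (≤-by (x * x * (1# - x)) (*-nonNeg (x*x-nonNeg x) (x≤y⇒0≤y-x x≤1))
      (solve 1 (λ x → (# 2 :- x) :* (# 1 :+ x :+ x :* x) := # 2 :+ x :+ x :* x :* (# 1 :- x)) refl x)))
    where
    1≤2 : 1# ≤ 2#
    1≤2 = x≤x+y 1# (fromℕ-nonNeg 1)
    x≤2 : x ≤ 2#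
    x≤2 = ≤-trans x≤1 1≤2
    0<2-x : 0# < 2# - x
    0<2-x = <-≤-trans 0<1 (≤-by (1# - x) (x≤y⇒0≤y-x x≤1)
      (solve 1 (λ x → # 2 :- x := # 1 :+ (# 1 :- x)) refl x))

  2+2x+x²≤2exp : ∀ {x} → 0# ≤ x → 2# + 2# * x + x * x ≤ 2# * exp x
  2+2x+x²≤2exp {x} 0≤x = subst (_≤ 2# * exp x) eq (*-monoʳ-≤ (fromℕ-nonNeg 2) (expSum≤exp 0≤x 3))
    where
    open ≡-Reasoning
    t₀ t₁ t₂ : ℝ
    t₀ = expTerm x 0
    t₁ = expTerm x 1
    t₂ = expTerm x 2
    eq : 2# * expSum x 3 ≡ 2# + 2# * x + x * x
    eq = begin
      2# * (0# + t₀ + t₁ + t₂)                     ≡⟨ solve 3 (λ a b c → # 2 :* (# 0 :+ a :+ b :+ c) := # 2 :* a :+ # 2 :* b :+ # 2 :* c) refl t₀ t₁ t₂ ⟩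
      2# * t₀ + 2# * t₁ + 2# * t₂                  ≡⟨ cong (2# * t₀ + 2# * t₁ +_) (expTerm-suc x 1) ⟩
      2# * t₀ + 2# * t₁ + x * t₁                   ≡⟨ cong (λ z → 2# * t₀ + 2# * z + x * z) t₁≡xt₀ ⟩
      2# * t₀ + 2# * (x * t₀) + x * (x * t₀)       ≡⟨ cong (λ z → 2# * z + 2# * (x * z) + x * (x * z)) (expTerm-0 x) ⟩
      2# * 1# + 2# * (x * 1#) + x * (x * 1#)       ≡⟨ solve 1 (λ x → # 2 :* # 1 :+ # 2 :* (x :* # 1) :+ x :* (x :* # 1) := # 2 :+ # 2 :* x :+ x :* x) refl x ⟩
      2# + 2# * x + x * x                          ∎
      where
      t₁≡xt₀ : t₁ ≡ x * t₀
      t₁≡xt₀ = *-assoc x _ _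

  exp-continuous-at-0 : ∀ {a b} → 0# ≤ a → a < b → ∃ λ η → 0# < η × a * exp η < b
  exp-continuous-at-0 {a} {b} 0≤a a<b = η , 0<η , ≤-<-trans aeη≤ (<-by _ (*-pos 0<η 0<2+D) b≡)
    where
    D c η : ℝ
    D = b - a
    -- The summand `D` gives η ≤ 1, so that a exp η ≤ a + 2aη. From cη = D, this falls short of `b`
    -- by exactly η(2+D).
    c = 2# * a + (2# + D)
    η = c ⁻¹ * D
    0≤2a : 0# ≤ 2# * a
    0≤2a = *-nonNeg (fromℕ-nonNeg 2) 0≤a
    0<D : 0# < D
    0<D = x<y⇒0<y-x a<b
    0<2+D : 0# < 2# + D
    0<2+D = <-≤-trans (0<fromℕ-suc 1) (x≤x+y 2# (proj₁ 0<D))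
    D≤c : D ≤ c
    D≤c = ≤-by (2# * a + 2#) (+-nonNeg 0≤2a (fromℕ-nonNeg 2))
      (solve 2 (λ a D → # 2 :* a :+ (# 2 :+ D) := D :+ (# 2 :* a :+ # 2)) refl a D)
    0<c : 0# < c
    0<c = <-≤-trans 0<D D≤c
    0<η : 0# < η
    0<η = *-pos (⁻¹-pos 0<c) 0<D
    cη≡D : c * η ≡ D
    cη≡D = x*[x⁻¹*y]≡y (>⇒≢ 0<c) D
    η≤1 : η ≤ 1#
    η≤1 = *-cancelˡ-≤ 0<c (subst₂ _≤_ (sym cη≡D) (sym (*-identityʳ c)) D≤c)
    aeη≤ : a * exp η ≤ a + 2# * a * η
    aeη≤ = ≤-trans (*-monoʳ-≤ 0≤a (exp≤1+x+x² (proj₁ 0<η) η≤1))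
      (≤-by (a * η * (1# - η)) (*-nonNeg (*-nonNeg 0≤a (proj₁ 0<η)) (x≤y⇒0≤y-x η≤1))
        (solve 2 (λ a η → a :+ # 2 :* a :* η := a :* (# 1 :+ η :+ η :* η) :+ a :* η :* (# 1 :- η)) refl a η))
    b≡ : b ≡ a + 2# * a * η + η * (2# + D)
    b≡ = begin
      b                                        ≡⟨ solve 2 (λ a b → b := a :+ (b :- a)) refl a b ⟩
      a + D                                    ≡⟨ cong (a +_) cη≡D ⟨
      a + c * η                                ≡⟨ solve 3 (λ a D η → a :+ (# 2 :* a :+ (# 2 :+ D)) :* η
                                                    := a :+ # 2 :* a :* η :+ η :* (# 2 :+ D)) refl a D η ⟩
      a + 2# * a * η + η * (2# + D)            ∎
      where open ≡-Reasoning

  -- Removes the error term at the end of both doubling arguments. Only small ε are asked for, since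
  -- the starting estimates hold only for those.
  exp-limit : ∀ {a b c w} → 0# ≤ b → 0# ≤ c → 0# < w →
              (∀ {ε} → 0# < ε → ε ≤ w → a ≤ b * exp (ε * c)) → a ≤ b
  exp-limit {a} {b} {c} {w} 0≤b 0≤c 0<w a≤be = ≮⇒≥ λ b<a → contradict (exp-continuous-at-0 0≤b b<a)
    where
    contradict : ¬ (∃ λ η → 0# < η × b * exp η < a)
    contradict (η , 0<η , beη<a) = <⇒≱ beη<a (≤-trans (a≤be 0<ε ε≤w)
        (*-monoʳ-≤ 0≤b (exp-mono-≤ (*-nonNeg (proj₁ 0<ε) 0≤c) εc≤η)))
      where
      k ε : ℝ
      k = η + w * c
      -- This is at most both `w` and η/c, in a form that still makes sense at c = 0.
      ε = k ⁻¹ * (η * w)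
      0<k : 0# < k
      0<k = <-≤-trans 0<η (x≤x+y η (*-nonNeg (proj₁ 0<w) 0≤c))
      0<ε : 0# < ε
      0<ε = *-pos (⁻¹-pos 0<k) (*-pos 0<η 0<w)
      kε≡ηw : k * ε ≡ η * w
      kε≡ηw = x*[x⁻¹*y]≡y (>⇒≢ 0<k) (η * w)
      ε≤w : ε ≤ w
      ε≤w = *-cancelˡ-≤ 0<k (subst (_≤ k * w) (sym kε≡ηw)
        (*-monoˡ-≤ (proj₁ 0<w) (x≤x+y η (*-nonNeg (proj₁ 0<w) 0≤c))))
      εc≤η : ε * c ≤ η
      εc≤η = *-cancelˡ-≤ 0<k (≤-by (η * η) (x*x-nonNeg η) (begin
        k * η                       ≡⟨ solve 3 (λ η w c → (η :+ w :* c) :* η := (η :* w) :* c :+ η :* η) refl η w c ⟩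
        (η * w) * c + η * η         ≡⟨ cong (λ z → z * c + η * η) kε≡ηw ⟨
        k * ε * c + η * η           ≡⟨ cong (_+ η * η) (*-assoc k ε c) ⟩
        k * (ε * c) + η * η         ∎))
        where open ≡-Reasoning

  log-isSupremum : ∀ {a} → 0# < a → IsSupremum (ExpAtMost a) (log a)
  log-isSupremum {a} 0<a with 0# <? a
  ... | yes 0<a′ = proj₂ (complete (ExpAtMost a) (log-nonempty 0<a′) (log-bounded 0<a′))
  ... | no  0≮a  = ⊥-elim (0≮a 0<a)

  exp-0 : exp 0# ≡ 1#
  exp-0 = ≤-antisym (exp-least ≤-refl expSum-0≤1) (1≤exp ≤-refl)

  log-nonNeg : ∀ {a} → 1# ≤ a → 0# ≤ log a
  log-nonNeg 1≤a = proj₁ (log-isSupremum (<-≤-trans 0<1 1≤a)) 0#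
    (≤-trans (≤-reflexive exp-0) 1≤a)

  -- If `exp (log a)` were below `a`, right continuity would put some `log a + η` with η > 0 into
  -- the set whose supremum is `log a`.
  a≤exp-log : ∀ {a} → 1# ≤ a → a ≤ exp (log a)
  a≤exp-log {a} 1≤a = ≮⇒≥ λ e<a → contradict (exp-continuous-at-0 (0≤exp 0≤l) e<a)
    where
    0≤l : 0# ≤ log a
    0≤l = log-nonNeg 1≤a
    contradict : ¬ (∃ λ η → 0# < η × exp (log a) * exp η < a)
    contradict (η , 0<η , eeη<a) = <⇒≱ 0<η (x+z≤x⇒z≤0 {log a} {η}
      (proj₁ (log-isSupremum (<-≤-trans 0<1 1≤a)) (log a + η)
        (subst (_≤ a) (sym (exp-+ 0≤l (proj₁ 0<η))) (proj₁ eeη<a))))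

-- Hoeffding's lemma for a Bernoulli variable, by doubling.

module HoeffdingLemma (R : RealNumbers) where
  open RealNumbers R
  open OrderedFieldProperties R
  open OrderedFieldLemmas R
  open Analysis R
  open Exponential R
  open IntegerCoefficients R

  ·-nonNeg : ∀ n {x} → 0# ≤ x → 0# ≤ fromℕ n * x
  ·-nonNeg n 0≤x = *-nonNeg (fromℕ-nonNeg n) 0≤x

  square-mono-≤ : ∀ {x y} → 0# ≤ x → x ≤ y → x * x ≤ y * y
  square-mono-≤ 0≤x x≤y = *-mono-≤ 0≤x (≤-trans 0≤x x≤y) x≤y x≤y

  quarter : ℝ
  quarter = fromℕ 4 ⁻¹

  0<quarter : 0# < quarter
  0<quarter = ⁻¹-pos (0<fromℕ-suc 3)

  v≤quarter⇒0≤1-4v : ∀ {v} → v ≤ quarter → 0# ≤ 1# - fromℕ 4 * v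
  v≤quarter⇒0≤1-4v {v} v≤q = x≤y⇒0≤y-x (subst (fromℕ 4 * v ≤_) (*-inverseʳ (fromℕ-suc≢0 3))
    (*-monoʳ-≤ (fromℕ-nonNeg 4) v≤q))

  -- The Archimedean property gives v ≤ (n+1)w. Since (n+2)/2 ≤ n+1, one halving lowers the
  -- multiplier by at least one, so induction on `n` does without powers of two.
  doubling-induction : (P : Pred ℝ 0ℓ) → ∀ {w} → 0# < w →
    (∀ {v} → 0# ≤ v → v ≤ w → P v) → (∀ {v} → 0# ≤ v → P v → P (v + v)) →
    ∀ {v} → 0# ≤ v → P v
  doubling-induction P {w} 0<w base step {v} 0≤v = bounded n 0≤v v≤[1+n]w
    where
    0≤w : 0# ≤ w
    0≤w = proj₁ 0<w
    n : ℕ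
    n = proj₁ (archimedean (w ⁻¹ * v))
    v≤[1+n]w : v ≤ fromℕ (suc n) * w
    v≤[1+n]w = ≤-trans
      (subst₂ _≤_ (x*[x⁻¹*y]≡y (>⇒≢ 0<w) v) (*-comm w (fromℕ n))
        (*-monoʳ-≤ 0≤w (proj₂ (archimedean (w ⁻¹ * v)))))
      (*-monoˡ-≤ 0≤w (fromℕ-mono-+ 1 n))
    bounded : ∀ n {v} → 0# ≤ v → v ≤ fromℕ (suc n) * w → P v
    bounded zero    {v} 0≤v v≤w = base 0≤v (subst (v ≤_) (solve 1 (λ w → (# 1 :+ # 0) :* w := w) refl w) v≤w)
    bounded (suc n) {v} 0≤v v≤[2+n]w = subst P u+u≡v (step 0≤u (bounded n 0≤u u≤[1+n]w))
      where
      u : ℝ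
      u = 2# ⁻¹ * v
      2u≡v : 2# * u ≡ v
      2u≡v = x*[x⁻¹*y]≡y (fromℕ-suc≢0 1) v
      u+u≡v : u + u ≡ v
      u+u≡v = trans (solve 1 (λ u → u :+ u := # 2 :* u) refl u) 2u≡v
      0≤u : 0# ≤ u
      0≤u = *-nonNeg (proj₁ (⁻¹-pos (0<fromℕ-suc 1))) 0≤v
      u≤[1+n]w : u ≤ fromℕ (suc n) * w
      u≤[1+n]w = *-cancelˡ-≤ (0<fromℕ-suc 1) (subst (_≤ 2# * (fromℕ (suc n) * w)) (sym 2u≡v)
        (≤-trans v≤[2+n]w (≤-by (fromℕ n * w) (·-nonNeg n 0≤w)
          (solve 2 (λ n w → # 2 :* ((# 1 :+ n) :* w) := (# 1 :+ (# 1 :+ n)) :* w :+ n :* w) refl (fromℕ n) w))))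

  -- In the rescaled variable v this says cosh (2v) ≤ exp (2v²).  The cubic error ε v² of the
  -- small-v estimate keeps its form under doubling because cosh (2y) ≤ (cosh y)⁴, so it holds
  -- everywhere, and ε is arbitrary.
  module Cosh where

    exponent : ℝ → ℝ → ℝ
    exponent k v = 2# * v + k * (v * v)

    -- The inequality cosh (2v) ≤ exp (kv²) multiplied by 2 exp (2v), which keeps the arguments of
    -- `exp` nonnegative.
    Bound : ℝ → Pred ℝ 0ℓ
    Bound k v = 1# + exp (fromℕ 4 * v) ≤ 2# * exp (exponent k v)

    exponent-nonNeg : ∀ {k v} → 0# ≤ k → 0# ≤ v → 0# ≤ exponent k v
    exponent-nonNeg 0≤k 0≤v = +-nonNeg (·-nonNeg 2 0≤v) (*-nonNeg 0≤k (x*x-nonNeg _))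

    -- After multiplication by c = 2 - 4v, the Padé bound makes the left side at most 4, and a
    -- quadratic lower bound for `exp` reduces the right side to a polynomial.
    near-zero : ∀ {ε v} → ε ≤ quarter → 0# ≤ v → v ≤ ε → Bound (2# + ε * fromℕ 12) v
    near-zero {ε} {v} ε≤¼ 0≤v v≤ε = *-cancelˡ-≤ 0<c
      (≤-trans lower (≤-trans middle (*-monoʳ-≤ (proj₁ 0<c) (2+2x+x²≤2exp 0≤z))))
      where
      z c z₀ r s : ℝ
      z = exponent (2# + ε * fromℕ 12) v
      c = 2# - fromℕ 4 * v
      z₀ = 2# * v + 2# * (v * v)
      r = fromℕ 12 * (ε * (v * v))
      s = 1# - fromℕ 4 * v
      0≤ε : 0# ≤ ε
      0≤ε = ≤-trans 0≤v v≤ε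
      0≤z : 0# ≤ z
      0≤z = exponent-nonNeg (+-nonNeg (fromℕ-nonNeg 2) (*-nonNeg 0≤ε (fromℕ-nonNeg 12))) 0≤v
      0≤s : 0# ≤ s
      0≤s = v≤quarter⇒0≤1-4v (≤-trans v≤ε ε≤¼)
      0<c : 0# < c
      0<c = <-≤-trans 0<1 (≤-by s 0≤s (solve 1 (λ v → # 2 :- # 4 :* v := # 1 :+ (# 1 :- # 4 :* v)) refl v))
      0≤v³ : 0# ≤ v * v * v
      0≤v³ = *-nonNeg (x*x-nonNeg v) 0≤v
      4v≤2 : fromℕ 4 * v ≤ 2#
      4v≤2 = 0≤y-x⇒x≤y (proj₁ 0<c)
      lower : c * (1# + exp (fromℕ 4 * v)) ≤ fromℕ 4
      lower = subst₂ _≤_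
        (solve 2 (λ v a → # 2 :- # 4 :* v :+ (# 2 :- # 4 :* v) :* a := (# 2 :- # 4 :* v) :* (# 1 :+ a)) refl v (exp (fromℕ 4 * v)))
        (solve 1 (λ v → # 2 :- # 4 :* v :+ (# 2 :+ # 4 :* v) := # 4) refl v)
        (+-monoʳ-≤ c ([2-x]*exp≤2+x (·-nonNeg 4 0≤v) 4v≤2))
      middle : fromℕ 4 ≤ c * (2# + 2# * z + z * z)
      middle = ≤-trans
        -- Here (2-4v)(2 + 2z₀ + z₀²) = 4 - 16v³ - 24v⁴ - 16v⁵ misses 4 at third order. The term
        -- 12εv² of the exponent, with ε ≥ v, contributes 24v³ to the second factor; 12 is the least
        -- integer for which this repairs the deficit up to v = 1/4.
        (≤-by (v * v * v * (fromℕ 30 * s + 1# + s * (1# + fromℕ 4 * v)))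
          (*-nonNeg 0≤v³ (+-nonNeg (+-nonNeg (·-nonNeg 30 0≤s) 0≤1)
            (*-nonNeg 0≤s (+-nonNeg 0≤1 (·-nonNeg 4 0≤v)))))
          (solve 1 (λ v → let z₀ = # 2 :* v :+ # 2 :* (v :* v); s = # 1 :- # 4 :* v in
            (# 2 :- # 4 :* v) :* (# 2 :+ # 2 :* z₀ :+ z₀ :* z₀ :+ # 24 :* (v :* v :* v))
              := # 4 :+ v :* v :* v :* (# 30 :* s :+ # 1 :+ s :* (# 1 :+ # 4 :* v))) refl v))
        (*-monoʳ-≤ (proj₁ 0<c)
          (≤-by (fromℕ 24 * (v * v * (ε - v)) + r * (2# * z₀ + r))
            (+-nonNeg (·-nonNeg 24 (*-nonNeg (x*x-nonNeg v) (x≤y⇒0≤y-x v≤ε)))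
              (*-nonNeg 0≤r (+-nonNeg (·-nonNeg 2 (exponent-nonNeg (fromℕ-nonNeg 2) 0≤v)) 0≤r)))
            (solve 2 (λ v ε → let z = # 2 :* v :+ (# 2 :+ ε :* # 12) :* (v :* v)
                                  z₀ = # 2 :* v :+ # 2 :* (v :* v)
                                  r = # 12 :* (ε :* (v :* v)) in
              # 2 :+ # 2 :* z :+ z :* z
                := # 2 :+ # 2 :* z₀ :+ z₀ :* z₀ :+ # 24 :* (v :* v :* v)
                   :+ (# 24 :* (v :* v :* (ε :- v)) :+ r :* (# 2 :* z₀ :+ r))) refl v ε)))
        where
        0≤r : 0# ≤ r
        0≤r = ·-nonNeg 12 (*-nonNeg 0≤ε (x*x-nonNeg v))

    -- With a = exp (2y), the inequality cosh (2y) ≤ (cosh y)⁴ is the identity (1+a)⁴ = 8a(1+a²) +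
    -- (1-a)⁴. Here y = 2v.
    doubling : ∀ {k v} → 0# ≤ k → 0# ≤ v → Bound k v → Bound k (v + v)
    doubling {k} {v} 0≤k 0≤v bound = *-cancelˡ-≤ (*-pos (0<fromℕ-suc 7) (0<exp 0≤4v))
      (subst₂ _≤_ (cong (λ z → fromℕ 8 * a * (1# + z)) (sym exp-8v)) (cong (λ z → fromℕ 8 * a * (2# * z)) (sym exp-e))
        (≤-trans
          (≤-by ((1# - a) * (1# - a) * ((1# - a) * (1# - a))) (x*x-nonNeg ((1# - a) * (1# - a)))
            (solve 1 (λ a → (# 1 :+ a) :* (# 1 :+ a) :* ((# 1 :+ a) :* (# 1 :+ a))
              := # 8 :* a :* (# 1 :+ a :* a) :+ (# 1 :- a) :* (# 1 :- a) :* ((# 1 :- a) :* (# 1 :- a))) refl a))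
          (subst ((1# + a) * (1# + a) * ((1# + a) * (1# + a)) ≤_) fourth-power
            (square-mono-≤ (x*x-nonNeg (1# + a)) (square-mono-≤ (+-nonNeg 0≤1 (0≤exp 0≤4v)) bound′)))))
      where
      open ≡-Reasoning
      a s b : ℝ
      a = exp (fromℕ 4 * v)
      s = exp (2# * v)
      b = exp (k * (v * v))
      0≤2v : 0# ≤ 2# * v
      0≤2v = ·-nonNeg 2 0≤v
      0≤4v : 0# ≤ fromℕ 4 * v
      0≤4v = ·-nonNeg 4 0≤v
      0≤kv² : 0# ≤ k * (v * v)
      0≤kv² = *-nonNeg 0≤k (x*x-nonNeg v)
      0≤2kv² : 0# ≤ k * (v * v) + k * (v * v)
      0≤2kv² = +-nonNeg 0≤kv² 0≤kv²
      s*s≡a : s * s ≡ a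
      s*s≡a = trans (sym (exp-+ 0≤2v 0≤2v)) (cong exp (solve 1 (λ v → # 2 :* v :+ # 2 :* v := # 4 :* v) refl v))
      exp-8v : exp (fromℕ 4 * (v + v)) ≡ a * a
      exp-8v = trans (cong exp (distribˡ _ v v)) (exp-+ 0≤4v 0≤4v)
      exp-e : exp (exponent k (v + v)) ≡ a * ((b * b) * (b * b))
      exp-e = begin
        exp (exponent k (v + v))
          ≡⟨ cong exp (solve 2 (λ k v → # 2 :* (v :+ v) :+ k :* ((v :+ v) :* (v :+ v))
               := # 4 :* v :+ ((k :* (v :* v) :+ k :* (v :* v)) :+ (k :* (v :* v) :+ k :* (v :* v)))) refl k v) ⟩
        exp (fromℕ 4 * v + ((k * (v * v) + k * (v * v)) + (k * (v * v) + k * (v * v))))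
          ≡⟨ exp-+ 0≤4v (+-nonNeg 0≤2kv² 0≤2kv²) ⟩
        a * exp ((k * (v * v) + k * (v * v)) + (k * (v * v) + k * (v * v)))
          ≡⟨ cong (a *_) (exp-+ 0≤2kv² 0≤2kv²) ⟩
        a * (exp (k * (v * v) + k * (v * v)) * exp (k * (v * v) + k * (v * v)))
          ≡⟨ cong (λ z → a * (z * z)) (exp-+ 0≤kv² 0≤kv²) ⟩
        a * ((b * b) * (b * b))
          ∎
      bound′ : 1# + a ≤ 2# * (s * b)
      bound′ = subst (λ z → 1# + a ≤ 2# * z) (exp-+ 0≤2v 0≤kv²) bound
      fourth-power : 2# * (s * b) * (2# * (s * b)) * (2# * (s * b) * (2# * (s * b)))
                     ≡ fromℕ 8 * a * (2# * (a * ((b * b) * (b * b))))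
      fourth-power = begin
        2# * (s * b) * (2# * (s * b)) * (2# * (s * b) * (2# * (s * b)))
          ≡⟨ solve 2 (λ s b → # 2 :* (s :* b) :* (# 2 :* (s :* b)) :* (# 2 :* (s :* b) :* (# 2 :* (s :* b)))
               := # 8 :* (s :* s) :* (# 2 :* ((s :* s) :* ((b :* b) :* (b :* b))))) refl s b ⟩
        fromℕ 8 * (s * s) * (2# * ((s * s) * ((b * b) * (b * b))))
          ≡⟨ cong (λ a → fromℕ 8 * a * (2# * (a * ((b * b) * (b * b))))) s*s≡a ⟩
        fromℕ 8 * a * (2# * (a * ((b * b) * (b * b))))
          ∎

    bound : ∀ {v} → 0# ≤ v → Bound 2# v
    bound {v} 0≤v = exp-limit (·-nonNeg 2 (0≤exp 0≤e)) (·-nonNeg 12 (x*x-nonNeg v)) 0<quarter approximate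
      where
      0≤e : 0# ≤ exponent 2# v
      0≤e = exponent-nonNeg (fromℕ-nonNeg 2) 0≤v
      approximate : ∀ {ε} → 0# < ε → ε ≤ quarter →
                    1# + exp (fromℕ 4 * v) ≤ 2# * exp (exponent 2# v) * exp (ε * (fromℕ 12 * (v * v)))
      approximate {ε} 0<ε ε≤¼ = subst (1# + exp (fromℕ 4 * v) ≤_) eq
        (doubling-induction (Bound k) 0<ε (near-zero ε≤¼)
          (doubling (+-nonNeg (fromℕ-nonNeg 2) (*-nonNeg (proj₁ 0<ε) (fromℕ-nonNeg 12)))) 0≤v)
        where
        open ≡-Reasoning
        k : ℝ
        k = 2# + ε * fromℕ 12
        eq : 2# * exp (exponent k v) ≡ 2# * exp (exponent 2# v) * exp (ε * (fromℕ 12 * (v * v)))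
        eq = begin
          2# * exp (exponent k v)
            ≡⟨ cong (λ z → 2# * exp z) (solve 2 (λ ε v → # 2 :* v :+ (# 2 :+ ε :* # 12) :* (v :* v)
                 := # 2 :* v :+ # 2 :* (v :* v) :+ ε :* (# 12 :* (v :* v))) refl ε v) ⟩
          2# * exp (exponent 2# v + ε * (fromℕ 12 * (v * v)))
            ≡⟨ cong (2# *_) (exp-+ 0≤e (*-nonNeg (proj₁ 0<ε) (·-nonNeg 12 (x*x-nonNeg v)))) ⟩
          2# * (exp (exponent 2# v) * exp (ε * (fromℕ 12 * (v * v))))
            ≡⟨ *-assoc 2# _ _ ⟨
          2# * exp (exponent 2# v) * exp (ε * (fromℕ 12 * (v * v)))
            ∎

  -- With λ = 4v, the bound M(λ) ≤ exp (qλ + λ²/8) on the moment generating function M of a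
  -- Bernoulli(q) variable.  Doubling uses M(2λ) ≤ M(λ)² cosh²(λ/2), which is the estimate
  -- q(1-q) ≤ 1/4 for the variance of the tilted variable.
  module Bernoulli {q : ℝ} (0≤q : 0# ≤ q) (0≤1-q : 0# ≤ 1# - q) where

    exponent : ℝ → ℝ
    exponent v = fromℕ 4 * (q * v) + 2# * (v * v)

    -- The error is linear in `v` because squaring the bound doubles it. The 16 comes from the
    -- quadratic term (4v)² of the crude estimate, which is at most 16εv for v ≤ ε.
    Bound : ℝ → Pred ℝ 0ℓ
    Bound ε v = 1# - q + q * exp (fromℕ 4 * v) ≤ exp (exponent v + ε * (fromℕ 16 * v))

    exponent-nonNeg : ∀ {v} → 0# ≤ v → 0# ≤ exponent v
    exponent-nonNeg 0≤v = +-nonNeg (·-nonNeg 4 (*-nonNeg 0≤q 0≤v)) (·-nonNeg 2 (x*x-nonNeg _))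

    near-zero : ∀ {ε v} → ε ≤ quarter → 0# ≤ v → v ≤ ε → Bound ε v
    near-zero {ε} {v} ε≤¼ 0≤v v≤ε = ≤-trans
      (+-monoʳ-≤ (1# - q) (*-monoʳ-≤ 0≤q
        (exp≤1+x+x² (·-nonNeg 4 0≤v) (0≤y-x⇒x≤y (v≤quarter⇒0≤1-4v (≤-trans v≤ε ε≤¼))))))
      (≤-trans
        (≤-by (2# * (v * v) + fromℕ 16 * ((ε - v) * v) + fromℕ 16 * (v * v * (1# - q)))
          (+-nonNeg (+-nonNeg (·-nonNeg 2 (x*x-nonNeg v)) (·-nonNeg 16 (*-nonNeg (x≤y⇒0≤y-x v≤ε) 0≤v)))
            (·-nonNeg 16 (*-nonNeg (x*x-nonNeg v) 0≤1-q)))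
          (solve 3 (λ q ε v → # 1 :+ (# 4 :* (q :* v) :+ # 2 :* (v :* v) :+ ε :* (# 16 :* v))
            := # 1 :- q :+ q :* (# 1 :+ # 4 :* v :+ # 4 :* v :* (# 4 :* v))
               :+ (# 2 :* (v :* v) :+ # 16 :* ((ε :- v) :* v) :+ # 16 :* (v :* v :* (# 1 :- q)))) refl q ε v))
        (1+x≤exp (+-nonNeg (exponent-nonNeg 0≤v) (*-nonNeg (≤-trans 0≤v v≤ε) (·-nonNeg 16 0≤v)))))

    doubling : ∀ {ε v} → 0# ≤ ε → 0# ≤ v → Bound ε v → Bound ε (v + v)
    doubling {ε} {v} 0≤ε 0≤v bound = *-cancelˡ-≤ (*-pos (0<fromℕ-suc 3) (0<exp 0≤4v))
      (subst₂ _≤_ (cong (λ z → fromℕ 4 * a * (1# - q + q * z)) (sym exp-8v)) eq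
        (≤-trans
          -- The discarded square vanishes for a = 1 and for qa = 1 - q, the case in which the
          -- tilted variable is a fair coin.
          (≤-by ((1# - q - q * a) * (a - 1#) * ((1# - q - q * a) * (a - 1#))) (x*x-nonNeg _)
            (solve 2 (λ q a → (# 1 :- q :+ q :* a) :* (# 1 :- q :+ q :* a) :* ((# 1 :+ a) :* (# 1 :+ a))
              := # 4 :* a :* (# 1 :- q :+ q :* (a :* a))
                 :+ (# 1 :- q :- q :* a) :* (a :- # 1) :* ((# 1 :- q :- q :* a) :* (a :- # 1))) refl q a))
          (*-mono-≤ (x*x-nonNeg N) (x*x-nonNeg (2# * (s * b)))
            (square-mono-≤ (+-nonNeg 0≤1-q (*-nonNeg 0≤q (0≤exp 0≤4v))) bound)
            (square-mono-≤ (+-nonNeg 0≤1 (0≤exp 0≤4v)) 1+a≤2sb))))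
      where
      open ≡-Reasoning
      e a s b N m : ℝ
      e = exponent v + ε * (fromℕ 16 * v)
      a = exp (fromℕ 4 * v)
      s = exp (2# * v)
      b = exp (2# * (v * v))
      N = 1# - q + q * a
      m = exp e
      0≤e : 0# ≤ e
      0≤e = +-nonNeg (exponent-nonNeg 0≤v) (*-nonNeg 0≤ε (·-nonNeg 16 0≤v))
      0≤2v : 0# ≤ 2# * v
      0≤2v = ·-nonNeg 2 0≤v
      0≤4v : 0# ≤ fromℕ 4 * v
      0≤4v = ·-nonNeg 4 0≤v
      0≤2v² : 0# ≤ 2# * (v * v)
      0≤2v² = ·-nonNeg 2 (x*x-nonNeg v)
      s*s≡a : s * s ≡ a
      s*s≡a = trans (sym (exp-+ 0≤2v 0≤2v)) (cong exp (solve 1 (λ v → # 2 :* v :+ # 2 :* v := # 4 :* v) refl v))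
      exp-8v : exp (fromℕ 4 * (v + v)) ≡ a * a
      exp-8v = trans (cong exp (distribˡ _ v v)) (exp-+ 0≤4v 0≤4v)
      1+a≤2sb : 1# + a ≤ 2# * (s * b)
      1+a≤2sb = subst (λ z → 1# + a ≤ 2# * z) (exp-+ 0≤2v 0≤2v²) (Cosh.bound 0≤v)
      eq : m * m * (2# * (s * b) * (2# * (s * b)))
           ≡ fromℕ 4 * a * exp (exponent (v + v) + ε * (fromℕ 16 * (v + v)))
      eq = begin
        m * m * (2# * (s * b) * (2# * (s * b)))
          ≡⟨ solve 3 (λ m s b → m :* m :* (# 2 :* (s :* b) :* (# 2 :* (s :* b)))
               := # 4 :* (s :* s) :* (m :* m :* (b :* b))) refl m s b ⟩
        fromℕ 4 * (s * s) * (m * m * (b * b))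
          ≡⟨ cong (λ z → fromℕ 4 * z * (m * m * (b * b))) s*s≡a ⟩
        fromℕ 4 * a * (m * m * (b * b))
          ≡⟨ cong (fromℕ 4 * a *_) (cong₂ _*_ (exp-+ 0≤e 0≤e) (exp-+ 0≤2v² 0≤2v²)) ⟨
        fromℕ 4 * a * (exp (e + e) * exp (2# * (v * v) + 2# * (v * v)))
          ≡⟨ cong (fromℕ 4 * a *_) (exp-+ (+-nonNeg 0≤e 0≤e) (+-nonNeg 0≤2v² 0≤2v²)) ⟨
        fromℕ 4 * a * exp (e + e + (2# * (v * v) + 2# * (v * v)))
          ≡⟨ cong (λ z → fromℕ 4 * a * exp z) (solve 3 (λ q ε v →
               let e = # 4 :* (q :* v) :+ # 2 :* (v :* v) :+ ε :* (# 16 :* v) in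
               e :+ e :+ (# 2 :* (v :* v) :+ # 2 :* (v :* v))
               := # 4 :* (q :* (v :+ v)) :+ # 2 :* ((v :+ v) :* (v :+ v)) :+ ε :* (# 16 :* (v :+ v))) refl q ε v) ⟩
        fromℕ 4 * a * exp (exponent (v + v) + ε * (fromℕ 16 * (v + v)))
          ∎

    hoeffding : ∀ {v} → 0# ≤ v → 1# - q + q * exp (fromℕ 4 * v) ≤ exp (exponent v)
    hoeffding {v} 0≤v = exp-limit (0≤exp 0≤e) (·-nonNeg 16 0≤v) 0<quarter
      λ {ε} 0<ε ε≤¼ → subst (1# - q + q * exp (fromℕ 4 * v) ≤_)
        (exp-+ 0≤e (*-nonNeg (proj₁ 0<ε) (·-nonNeg 16 0≤v)))
        (doubling-induction (Bound ε) 0<ε (near-zero ε≤¼) (doubling (proj₁ 0<ε)) 0≤v)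
      where
      0≤e : 0# ≤ exponent v
      0≤e = exponent-nonNeg 0≤v

-- Squared Euclidean distance of bit vectors as Hamming distance.

module Hamming (R : RealNumbers) where
  open RealNumbers R
  open OrderedFieldProperties R
  open OrderedFieldLemmas R
  open SquareRoot R
  open Analysis R
  open RandomizedResponse R
  open IntegerCoefficients R

  hamming : ∀ {d} → Vec Bool d → Vec Bool d → ℝ
  hamming []      []      = 0#
  hamming (a ∷ x) (b ∷ y) = bit (a xor b) + hamming x y

  bit-nonNeg : ∀ b → 0# ≤ bit b
  bit-nonNeg false = ≤-refl
  bit-nonNeg true  = 0≤1

  hamming-nonNeg : ∀ {d} (x y : Vec Bool d) → 0# ≤ hamming x y
  hamming-nonNeg []      []      = ≤-refl
  hamming-nonNeg (a ∷ x) (b ∷ y) = +-nonNeg (bit-nonNeg (a xor b)) (hamming-nonNeg x y)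

  [bit-bit]² : ∀ a b → (bit a - bit b) ^ 2 ≡ bit (a xor b)
  [bit-bit]² false false = solve 0 ((# 0 :- # 0) :* ((# 0 :- # 0) :* # 1) := # 0) refl
  [bit-bit]² false true  = solve 0 ((# 0 :- # 1) :* ((# 0 :- # 1) :* # 1) := # 1) refl
  [bit-bit]² true  false = solve 0 ((# 1 :- # 0) :* ((# 1 :- # 0) :* # 1) := # 1) refl
  [bit-bit]² true  true  = solve 0 ((# 1 :- # 1) :* ((# 1 :- # 1) :* # 1) := # 0) refl

  squareSum≡hamming : ∀ {d} (x y : Vec Bool d) → foldr′ _+_ 0# (map (_^ 2) (bits x -ᵛ bits y)) ≡ hamming x y
  squareSum≡hamming []      []      = refl
  squareSum≡hamming (a ∷ x) (b ∷ y) = cong₂ _+_ ([bit-bit]² a b) (squareSum≡hamming x y)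

  dist²≡hamming : ∀ {d} (x y : Vec Bool d) → dist² x y ≡ hamming x y
  dist²≡hamming x y = trans (cong (λ a → √ a ^ 2) (squareSum≡hamming x y))
    (trans (x^2≡x*x _) (√-square (hamming-nonNeg x y)))

  bit-not : ∀ b → bit (not b) ≡ 1# - bit b
  bit-not false = solve 0 (# 1 := # 1 :- # 0) refl
  bit-not true  = solve 0 (# 0 := # 1 :- # 1) refl

  not-xor-xor : ∀ a b c d → (not a xor b) xor (c xor d) ≡ not ((a xor b) xor (c xor d))
  not-xor-xor false false c     d     = refl
  not-xor-xor false true  false false = refl
  not-xor-xor false true  false true  = refl
  not-xor-xor false true  true  false = refl
  not-xor-xor false true  true  true  = refl
  not-xor-xor true  false false false = refl
  not-xor-xor true  false false true  = refl
  not-xor-xor true  false true  false = refl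
  not-xor-xor true  false true  true  = refl
  not-xor-xor true  true  c     d     = refl

  publishedDistance : ∀ {d} → Vec Bool d → Vec Bool d → Outcome d → ℝ
  publishedDistance x y ω = hamming (published₁ x ω) (published₂ y ω)

  publishedDistance-nonNeg : ∀ {d} (x y : Vec Bool d) ω → 0# ≤ publishedDistance x y ω
  publishedDistance-nonNeg x y ω = hamming-nonNeg (published₁ x ω) (published₂ y ω)

  -- Complementing a bit commutes with flipping it, so on the same outcome each coordinate changes
  -- between agreement and disagreement. This reflection exchanges the two tails.
  publishedDistance-not : ∀ {d} (x y : Vec Bool d) ω →
    publishedDistance (map not x) y ω ≡ fromℕ d - publishedDistance x y ω
  publishedDistance-not [] [] ([] , []) = sym (-‿inverseʳ 0#)
  publishedDistance-not {suc d} (a ∷ x) (b ∷ y) (f ∷ fs , g ∷ gs) = trans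
    (cong₂ _+_ (trans (cong bit (not-xor-xor a f b g)) (bit-not ((a xor f) xor (b xor g))))
      (publishedDistance-not x y (fs , gs)))
    (solve 3 (λ z n h → # 1 :- z :+ (n :- h) := # 1 :+ n :- (z :+ h)) refl
      (bit ((a xor f) xor (b xor g))) (fromℕ d) (publishedDistance x y (fs , gs)))

-- Expectation under the product law of the flips.

module Expectation (R : RealNumbers) where
  open RealNumbers R
  open OrderedFieldProperties R
  open OrderedFieldLemmas R
  open RandomizedResponse R
  open IntegerCoefficients R

  sumCube-cong : ∀ d {h k : Vec Bool d → ℝ} → (∀ v → h v ≡ k v) → sumCube d h ≡ sumCube d k
  sumCube-cong zero    eq = eq []
  sumCube-cong (suc d) eq = cong₂ _+_ (sumCube-cong d (λ v → eq (false ∷ v))) (sumCube-cong d (λ v → eq (true ∷ v)))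

  sumCube-mono-≤ : ∀ d {h k : Vec Bool d → ℝ} → (∀ v → h v ≤ k v) → sumCube d h ≤ sumCube d k
  sumCube-mono-≤ zero    le = le []
  sumCube-mono-≤ (suc d) le = +-mono-≤ (sumCube-mono-≤ d (λ v → le (false ∷ v))) (sumCube-mono-≤ d (λ v → le (true ∷ v)))

  sumCube-+ : ∀ d (h k : Vec Bool d → ℝ) → sumCube d (λ v → h v + k v) ≡ sumCube d h + sumCube d k
  sumCube-+ zero    h k = refl
  sumCube-+ (suc d) h k = trans (cong₂ _+_ (sumCube-+ d _ _) (sumCube-+ d _ _))
    (solve 4 (λ a b c d → a :+ b :+ (c :+ d) := a :+ c :+ (b :+ d)) refl _ _ _ _)

  sumCube-*ˡ : ∀ d c (h : Vec Bool d → ℝ) → sumCube d (λ v → c * h v) ≡ c * sumCube d h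
  sumCube-*ˡ zero    c h = refl
  sumCube-*ˡ (suc d) c h = trans (cong₂ _+_ (sumCube-*ˡ d c _) (sumCube-*ˡ d c _)) (sym (distribˡ c _ _))

  module _ (p : ℝ) where

    E-cong : ∀ {d} {X Y : Outcome d → ℝ} → (∀ ω → X ω ≡ Y ω) → E p X ≡ E p Y
    E-cong {d} eq = sumCube-cong d λ f → sumCube-cong d λ g → cong (prob p (f , g) *_) (eq (f , g))

    E-+ : ∀ {d} (X Y : Outcome d → ℝ) → E p (λ ω → X ω + Y ω) ≡ E p X + E p Y
    E-+ {d} X Y = trans
      (sumCube-cong d λ f → trans (sumCube-cong d λ g → distribˡ (prob p (f , g)) _ _) (sumCube-+ d _ _))
      (sumCube-+ d _ _)

    E-*ˡ : ∀ {d} c (X : Outcome d → ℝ) → E p (λ ω → c * X ω) ≡ c * E p X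
    E-*ˡ {d} c X = trans
      (sumCube-cong d λ f → trans
        (sumCube-cong d λ g → solve 3 (λ q c x → q :* (c :* x) := c :* (q :* x)) refl (prob p (f , g)) c (X (f , g)))
        (sumCube-*ˡ d c _))
      (sumCube-*ˡ d c _)

    bitMean : (Bool → Bool → ℝ) → ℝ
    bitMean h = ((1# - p) * (1# - p) * h false false + (1# - p) * p * h false true)
              + (p * (1# - p) * h true false + p * p * h true true)

    prepend : ∀ {d} → Bool → Bool → Outcome d → Outcome (suc d)
    prepend b c (f , g) = b ∷ f , c ∷ g

    -- Conditioning on the two flips of the first coordinate: their weights factor out of the
    -- product law. This is where independence across coordinates enters.
    E-suc : ∀ {d} (X : Outcome (suc d) → ℝ) → E p X ≡ bitMean (λ b c → E p (X ∘ prepend b c))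
    E-suc {d} X = cong₂ _+_ (row false) (row true)
      where
      entry : ∀ b c → sumCube d (λ f → sumCube d (λ g → prob p (b ∷ f , c ∷ g) * X (b ∷ f , c ∷ g)))
                      ≡ flipProb p b * flipProb p c * E p (X ∘ prepend b c)
      entry b c = trans
        (sumCube-cong d λ f → trans
          (sumCube-cong d λ g → solve 5 (λ α β φ γ x → α :* φ :* (β :* γ) :* x := α :* β :* (φ :* γ :* x)) refl
            (flipProb p b) (flipProb p c) (flipsProb p f) (flipsProb p g) (X (b ∷ f , c ∷ g)))
          (sumCube-*ˡ d _ _))
        (sumCube-*ˡ d _ _)
      row : ∀ b → _ ≡ flipProb p b * flipProb p false * E p (X ∘ prepend b false)
                    + flipProb p b * flipProb p true * E p (X ∘ prepend b true)
      row b = trans (sumCube-+ d _ _) (cong₂ _+_ (entry b false) (entry b true))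

    bitMean-cong : ∀ {h k} → (∀ b c → h b c ≡ k b c) → bitMean h ≡ bitMean k
    bitMean-cong eq = cong₂ _+_
      (cong₂ _+_ (cong ((1# - p) * (1# - p) *_) (eq false false)) (cong ((1# - p) * p *_) (eq false true)))
      (cong₂ _+_ (cong (p * (1# - p) *_) (eq true false)) (cong (p * p *_) (eq true true)))

    E-1 : ∀ d → E p {d} (λ _ → 1#) ≡ 1#
    E-1 zero    = solve 0 (# 1 :* # 1 :* # 1 := # 1) refl
    E-1 (suc d) = trans (E-suc {d} (λ _ → 1#)) (trans (bitMean-cong {k = λ _ _ → 1#} (λ _ _ → E-1 d))
      (solve 1 (λ p → ((# 1 :- p) :* (# 1 :- p) :* # 1 :+ (# 1 :- p) :* p :* # 1)
                      :+ (p :* (# 1 :- p) :* # 1 :+ p :* p :* # 1) := # 1) refl p))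

    E-const : ∀ d c → E p {d} (λ _ → c) ≡ c
    E-const d c = begin
      E p {d} (λ _ → c)          ≡⟨ E-cong {d} (λ _ → *-identityʳ c) ⟨
      E p {d} (λ _ → c * 1#)     ≡⟨ E-*ˡ {d} c (λ _ → 1#) ⟩
      c * E p {d} (λ _ → 1#)     ≡⟨ cong (c *_) (E-1 d) ⟩
      c * 1#                     ≡⟨ *-identityʳ c ⟩
      c                          ∎
      where open ≡-Reasoning

    module _ (0≤p : 0# ≤ p) (0≤1-p : 0# ≤ 1# - p) where

      flipProb-nonNeg : ∀ b → 0# ≤ flipProb p b
      flipProb-nonNeg false = 0≤1-p
      flipProb-nonNeg true  = 0≤p

      flipsProb-nonNeg : ∀ {d} (f : Vec Bool d) → 0# ≤ flipsProb p f
      flipsProb-nonNeg []      = 0≤1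
      flipsProb-nonNeg (b ∷ f) = *-nonNeg (flipProb-nonNeg b) (flipsProb-nonNeg f)

      E-mono-≤ : ∀ {d} {X Y : Outcome d → ℝ} → (∀ ω → X ω ≤ Y ω) → E p X ≤ E p Y
      E-mono-≤ {d} le = sumCube-mono-≤ d λ f → sumCube-mono-≤ d λ g →
        *-monoʳ-≤ (*-nonNeg (flipsProb-nonNeg f) (flipsProb-nonNeg g)) (le (f , g))

      -- Markov's inequality and the union bound in one step: the pointwise inequality 1 ≤ 1_A + S +
      -- T is integrated, with `S` and `T` in place of the indicators of the two tails.
      union-bound : ∀ {d} {A : Pred (Outcome d) 0ℓ} (A? : Decidable A) (S T : Outcome d → ℝ) →
        (∀ ω → 0# ≤ S ω) → (∀ ω → 0# ≤ T ω) → (∀ ω → ¬ A ω → 1# ≤ S ω + T ω) →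
        1# ≤ Pr p A? + (E p S + E p T)
      union-bound {d} {A} A? S T 0≤S 0≤T covered = subst₂ _≤_ (E-1 d)
        (trans (E-+ _ (λ ω → S ω + T ω)) (cong (Pr p A? +_) (E-+ S T)))
        (E-mono-≤ pointwise)
        where
        pointwise : ∀ ω → 1# ≤ (if does (A? ω) then 1# else 0#) + (S ω + T ω)
        pointwise ω with A? ω
        ... | yes _ = x≤x+y 1# (+-nonNeg (0≤S ω) (0≤T ω))
        ... | no ¬A = subst (1# ≤_) (sym (+-identityˡ _)) (covered ω ¬A)

-- Mean, moment generating function and tail of the published distance.

module DistanceLaw (R : RealNumbers) where
  open RealNumbers R
  open OrderedFieldProperties R
  open OrderedFieldLemmas R
  open Analysis R
  open RandomizedResponse R
  open Exponential R
  open HoeffdingLemma R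
  open Hamming R
  open Expectation R
  open IntegerCoefficients R

  module _ (p : ℝ) where

    -- The probability that two published bits differ, given whether the true bits do.
    rate : Bool → ℝ
    rate false = 2# * p * (1# - p)
    rate true  = 1# - 2# * p * (1# - p)

    -- The published bits differ according to (a xor b) xor (f xor g), and f xor g is true with
    -- probability 2p(1-p). The test function `φ` is arbitrary so that the mean and the moment
    -- generating function both follow.
    bitMean-xor : ∀ a b (φ : Bool → ℝ) → bitMean p (λ f g → φ ((a xor f) xor (b xor g)))
                  ≡ (1# - rate (a xor b)) * φ false + rate (a xor b) * φ true
    bitMean-xor false false φ = solve 3 (λ p s t → let q = # 2 :* p :* (# 1 :- p) in
      ((# 1 :- p) :* (# 1 :- p) :* s :+ (# 1 :- p) :* p :* t) :+ (p :* (# 1 :- p) :* t :+ p :* p :* s)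
        := (# 1 :- q) :* s :+ q :* t) refl p (φ false) (φ true)
    bitMean-xor true true φ = solve 3 (λ p s t → let q = # 2 :* p :* (# 1 :- p) in
      ((# 1 :- p) :* (# 1 :- p) :* s :+ (# 1 :- p) :* p :* t) :+ (p :* (# 1 :- p) :* t :+ p :* p :* s)
        := (# 1 :- q) :* s :+ q :* t) refl p (φ false) (φ true)
    bitMean-xor false true φ = solve 3 (λ p s t → let q = # 1 :- # 2 :* p :* (# 1 :- p) in
      ((# 1 :- p) :* (# 1 :- p) :* t :+ (# 1 :- p) :* p :* s) :+ (p :* (# 1 :- p) :* s :+ p :* p :* t)
        := (# 1 :- q) :* s :+ q :* t) refl p (φ false) (φ true)
    bitMean-xor true false φ = solve 3 (λ p s t → let q = # 1 :- # 2 :* p :* (# 1 :- p) in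
      ((# 1 :- p) :* (# 1 :- p) :* t :+ (# 1 :- p) :* p :* s) :+ (p :* (# 1 :- p) :* s :+ p :* p :* t)
        := (# 1 :- q) :* s :+ q :* t) refl p (φ false) (φ true)

    μ : ∀ {d} → Vec Bool d → Vec Bool d → ℝ
    μ []      []      = 0#
    μ (a ∷ x) (b ∷ y) = rate (a xor b) + μ x y

    -- Because 1 - 4p(1-p) = (1-2p)², the rate is affine in the true difference bit. Its offset and
    -- slope are the centring and scaling constants of the estimator.
    rate≡ : ∀ b → rate b ≡ 2# * p * (1# - p) + (1# - 2# * p) ^ 2 * bit b
    rate≡ false = solve 1 (λ p → # 2 :* p :* (# 1 :- p)
      := # 2 :* p :* (# 1 :- p) :+ (# 1 :- # 2 :* p) :* ((# 1 :- # 2 :* p) :* # 1) :* # 0) refl p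
    rate≡ true = solve 1 (λ p → # 1 :- # 2 :* p :* (# 1 :- p)
      := # 2 :* p :* (# 1 :- p) :+ (# 1 :- # 2 :* p) :* ((# 1 :- # 2 :* p) :* # 1) :* # 1) refl p

    μ≡ : ∀ {d} (x y : Vec Bool d) → μ x y ≡ 2# * fromℕ d * p * (1# - p) + (1# - 2# * p) ^ 2 * hamming x y
    μ≡ []      []      = solve 2 (λ p s → # 0 := # 2 :* # 0 :* p :* (# 1 :- p) :+ s :* # 0) refl p ((1# - 2# * p) ^ 2)
    μ≡ {suc d} (a ∷ x) (b ∷ y) = trans (cong₂ _+_ (rate≡ (a xor b)) (μ≡ x y))
      (solve 5 (λ p n s z h → # 2 :* p :* (# 1 :- p) :+ s :* z :+ (# 2 :* n :* p :* (# 1 :- p) :+ s :* h)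
        := # 2 :* (# 1 :+ n) :* p :* (# 1 :- p) :+ s :* (z :+ h)) refl
        p (fromℕ d) ((1# - 2# * p) ^ 2) (bit (a xor b)) (hamming x y))

    rate-not : ∀ a b → rate (not a xor b) ≡ 1# - rate (a xor b)
    rate-not false false = refl
    rate-not true  true  = refl
    rate-not false true  = solve 1 (λ q → q := # 1 :- (# 1 :- q)) refl (rate false)
    rate-not true  false = solve 1 (λ q → q := # 1 :- (# 1 :- q)) refl (rate false)

    μ-not : ∀ {d} (x y : Vec Bool d) → μ (map not x) y ≡ fromℕ d - μ x y
    μ-not [] [] = sym (-‿inverseʳ 0#)
    μ-not {suc d} (a ∷ x) (b ∷ y) = trans (cong₂ _+_ (rate-not a b) (μ-not x y))
      (solve 3 (λ r n m → # 1 :- r :+ (n :- m) := # 1 :+ n :- (r :+ m)) refl (rate (a xor b)) (fromℕ d) (μ x y))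

    E-publishedDistance : ∀ {d} (x y : Vec Bool d) → E p (publishedDistance x y) ≡ μ x y
    E-publishedDistance []      []      = zeroʳ _
    E-publishedDistance {suc d} (a ∷ x) (b ∷ y) = begin
      E p (publishedDistance (a ∷ x) (b ∷ y))
        ≡⟨ E-suc p (publishedDistance (a ∷ x) (b ∷ y)) ⟩
      bitMean p (λ f g → E p (λ ω → bit (z f g) + publishedDistance x y ω))
        ≡⟨ bitMean-cong p (λ f g → trans (E-+ p (λ _ → bit (z f g)) (publishedDistance x y))
             (cong₂ _+_ (E-const p d (bit (z f g))) (E-publishedDistance x y))) ⟩
      bitMean p (λ f g → bit (z f g) + μ x y)
        ≡⟨ bitMean-xor a b (λ c → bit c + μ x y) ⟩
      (1# - rate (a xor b)) * (0# + μ x y) + rate (a xor b) * (1# + μ x y)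
        ≡⟨ solve 2 (λ r m → (# 1 :- r) :* (# 0 :+ m) :+ r :* (# 1 :+ m) := r :+ m) refl (rate (a xor b)) (μ x y) ⟩
      rate (a xor b) + μ x y
        ∎
      where
      open ≡-Reasoning
      z : Bool → Bool → Bool
      z f g = (a xor f) xor (b xor g)

    module _ (0≤p : 0# ≤ p) (0≤1-p : 0# ≤ 1# - p) where

      rate-false-nonNeg : 0# ≤ rate false
      rate-false-nonNeg = *-nonNeg (*-nonNeg (fromℕ-nonNeg 2) 0≤p) 0≤1-p

      rate-true-nonNeg : 0# ≤ rate true
      rate-true-nonNeg = subst (0# ≤_)
        (solve 1 (λ p → p :* p :+ (# 1 :- p) :* (# 1 :- p) := # 1 :- # 2 :* p :* (# 1 :- p)) refl p)
        (+-nonNeg (x*x-nonNeg p) (x*x-nonNeg (1# - p)))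

      rate-nonNeg : ∀ b → 0# ≤ rate b
      rate-nonNeg false = rate-false-nonNeg
      rate-nonNeg true  = rate-true-nonNeg

      1-rate-nonNeg : ∀ b → 0# ≤ 1# - rate b
      1-rate-nonNeg false = rate-true-nonNeg
      1-rate-nonNeg true  = subst (0# ≤_) (solve 1 (λ q → q := # 1 :- (# 1 :- q)) refl (rate false)) rate-false-nonNeg

      μ-nonNeg : ∀ {d} (x y : Vec Bool d) → 0# ≤ μ x y
      μ-nonNeg []      []      = ≤-refl
      μ-nonNeg (a ∷ x) (b ∷ y) = +-nonNeg (rate-nonNeg (a xor b)) (μ-nonNeg x y)

      -- This is λμ + dλ²/8 at λ = 4v.
      mgfExponent : ∀ {d} → ℝ → Vec Bool d → Vec Bool d → ℝ
      mgfExponent {d} v x y = fromℕ 4 * v * μ x y + fromℕ d * (2# * (v * v))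

      mgfExponent-nonNeg : ∀ {d v} (x y : Vec Bool d) → 0# ≤ v → 0# ≤ mgfExponent v x y
      mgfExponent-nonNeg {d} x y 0≤v = +-nonNeg (*-nonNeg (·-nonNeg 4 0≤v) (μ-nonNeg x y))
        (·-nonNeg d (·-nonNeg 2 (x*x-nonNeg _)))

      -- The moment generating function factors over the coordinates; Hoeffding's lemma bounds each
      -- factor and the exponents add up.
      mgf-bound : ∀ {d v} (x y : Vec Bool d) → 0# ≤ v →
        E p (λ ω → exp (fromℕ 4 * v * publishedDistance x y ω)) ≤ exp (mgfExponent v x y)
      mgf-bound {v = v} [] [] 0≤v = ≤-reflexive (trans
        (solve 1 (λ e → # 1 :* # 1 :* e := e) refl (exp (fromℕ 4 * v * 0#)))
        (cong exp (solve 1 (λ v → # 4 :* v :* # 0 := # 4 :* v :* # 0 :+ # 0 :* (# 2 :* (v :* v))) refl v)))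
      mgf-bound {suc d} {v} (a ∷ x) (b ∷ y) 0≤v = subst₂ _≤_ (sym lhs) (sym rhs)
        (*-mono-≤ (+-nonNeg (1-rate-nonNeg (a xor b)) (*-nonNeg (rate-nonNeg (a xor b)) (0≤exp 0≤4v)))
          (0≤exp (mgfExponent-nonNeg x y 0≤v))
          (Bernoulli.hoeffding (rate-nonNeg (a xor b)) (1-rate-nonNeg (a xor b)) 0≤v) (mgf-bound x y 0≤v))
        where
        open ≡-Reasoning
        r M : ℝ
        r = rate (a xor b)
        M = E p (λ ω → exp (fromℕ 4 * v * publishedDistance x y ω))
        0≤4v : 0# ≤ fromℕ 4 * v
        0≤4v = ·-nonNeg 4 0≤v
        z : Bool → Bool → Bool
        z f g = (a xor f) xor (b xor g)
        φ : Bool → ℝ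
        φ c = exp (fromℕ 4 * v * bit c)
        split : ∀ c ω → exp (fromℕ 4 * v * (bit c + publishedDistance x y ω))
                        ≡ φ c * exp (fromℕ 4 * v * publishedDistance x y ω)
        split c ω = trans (cong exp (distribˡ _ _ _))
          (exp-+ (*-nonNeg 0≤4v (bit-nonNeg c)) (*-nonNeg 0≤4v (publishedDistance-nonNeg x y ω)))
        φ-false : φ false ≡ 1#
        φ-false = trans (cong exp (zeroʳ _)) exp-0
        φ-true : φ true ≡ exp (fromℕ 4 * v)
        φ-true = cong exp (*-identityʳ _)
        lhs : E p (λ ω → exp (fromℕ 4 * v * publishedDistance (a ∷ x) (b ∷ y) ω))
              ≡ (1# - r + r * exp (fromℕ 4 * v)) * M
        lhs = begin
          E p (λ ω → exp (fromℕ 4 * v * publishedDistance (a ∷ x) (b ∷ y) ω))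
            ≡⟨ E-suc p (λ ω → exp (fromℕ 4 * v * publishedDistance (a ∷ x) (b ∷ y) ω)) ⟩
          bitMean p (λ f g → E p (λ ω → exp (fromℕ 4 * v * (bit (z f g) + publishedDistance x y ω))))
            ≡⟨ bitMean-cong p (λ f g → trans (E-cong p (split (z f g)))
                 (E-*ˡ p (φ (z f g)) (λ ω → exp (fromℕ 4 * v * publishedDistance x y ω)))) ⟩
          bitMean p (λ f g → φ (z f g) * M)
            ≡⟨ bitMean-xor a b (λ c → φ c * M) ⟩
          (1# - r) * (φ false * M) + r * (φ true * M)
            ≡⟨ cong₂ (λ s t → (1# - r) * (s * M) + r * (t * M)) φ-false φ-true ⟩
          (1# - r) * (1# * M) + r * (exp (fromℕ 4 * v) * M)
            ≡⟨ solve 3 (λ r e m → (# 1 :- r) :* (# 1 :* m) :+ r :* (e :* m) := (# 1 :- r :+ r :* e) :* m) refl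
                 r (exp (fromℕ 4 * v)) M ⟩
          (1# - r + r * exp (fromℕ 4 * v)) * M
            ∎
        rhs : exp (mgfExponent v (a ∷ x) (b ∷ y))
              ≡ exp (fromℕ 4 * (r * v) + 2# * (v * v)) * exp (mgfExponent v x y)
        rhs = trans
          (cong exp (solve 4 (λ v r m n → # 4 :* v :* (r :+ m) :+ (# 1 :+ n) :* (# 2 :* (v :* v))
            := # 4 :* (r :* v) :+ # 2 :* (v :* v) :+ (# 4 :* v :* m :+ n :* (# 2 :* (v :* v)))) refl
            v r (μ x y) (fromℕ d)))
          (exp-+ (Bernoulli.exponent-nonNeg (rate-nonNeg (a xor b)) (1-rate-nonNeg (a xor b)) 0≤v)
            (mgfExponent-nonNeg x y 0≤v))

      -- The threshold is t = dv, for which λ = 4v is the optimal choice. The hypothesis `1≤e` says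
      -- exp (-2dv²) ≤ ε without a negative exponent.
      module UpperTail {d : ℕ} {v ε : ℝ} (0≤v : 0# ≤ v)
                       (1≤e : 1# ≤ ε * exp (fromℕ d * (2# * (v * v)))) (x y : Vec Bool d) where

        K : ℝ
        K = exp (fromℕ 4 * v * (μ x y + fromℕ d * v))

        0≤4v : 0# ≤ fromℕ 4 * v
        0≤4v = ·-nonNeg 4 0≤v

        0≤μ+dv : 0# ≤ μ x y + fromℕ d * v
        0≤μ+dv = +-nonNeg (μ-nonNeg x y) (·-nonNeg d 0≤v)

        0<K : 0# < K
        0<K = 0<exp (*-nonNeg 0≤4v 0≤μ+dv)

        tail : Outcome d → ℝ
        tail ω = K ⁻¹ * exp (fromℕ 4 * v * publishedDistance x y ω)

        tail-nonNeg : ∀ ω → 0# ≤ tail ω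
        tail-nonNeg ω = *-nonNeg (proj₁ (⁻¹-pos 0<K))
          (0≤exp (*-nonNeg 0≤4v (publishedDistance-nonNeg x y ω)))

        1≤tail : ∀ ω → μ x y + fromℕ d * v ≤ publishedDistance x y ω → 1# ≤ tail ω
        1≤tail ω le = subst (_≤ tail ω) (*-inverseˡ (>⇒≢ 0<K))
          (*-monoʳ-≤ (proj₁ (⁻¹-pos 0<K)) (exp-mono-≤ (*-nonNeg 0≤4v 0≤μ+dv) (*-monoʳ-≤ 0≤4v le)))

        E-tail≤ε : E p tail ≤ ε
        E-tail≤ε = subst (_≤ ε) (sym (E-*ˡ p {d} (K ⁻¹) _)) (*-cancelˡ-≤ 0<K
          (subst (_≤ K * ε) (sym (x*[x⁻¹*y]≡y (>⇒≢ 0<K) _)) (≤-trans (mgf-bound x y 0≤v) A≤Kε)))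
          where
          A D : ℝ
          A = mgfExponent v x y
          D = fromℕ d * (2# * (v * v))
          -- The exponent λt = 4dv² is twice dλ²/8 = 2dv², so division by `K` leaves exactly exp
          -- (-2dv²).
          K≡ : K ≡ exp A * exp D
          K≡ = trans
            (cong exp (solve 3 (λ v m n → # 4 :* v :* (m :+ n :* v)
              := # 4 :* v :* m :+ n :* (# 2 :* (v :* v)) :+ n :* (# 2 :* (v :* v))) refl v (μ x y) (fromℕ d)))
            (exp-+ (mgfExponent-nonNeg x y 0≤v) (·-nonNeg d (·-nonNeg 2 (x*x-nonNeg v))))
          A≤Kε : exp A ≤ K * ε
          A≤Kε = subst₂ _≤_ (*-identityʳ _)
            (trans (solve 3 (λ a e d → a :* (e :* d) := a :* d :* e) refl (exp A) ε (exp D)) (cong (_* ε) (sym K≡)))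
            (*-monoʳ-≤ (0≤exp (mgfExponent-nonNeg x y 0≤v)) 1≤e)

-- Unbiasedness and the two-sided deviation bound.

module Estimator (R : RealNumbers) where
  open RealNumbers R
  open OrderedFieldProperties R
  open OrderedFieldLemmas R
  open SquareRoot R
  open Analysis R
  open RandomizedResponse R
  open Exponential R
  open Hamming R
  open Expectation R
  open DistanceLaw R
  open IntegerCoefficients R

  ∣x∣≤y : ∀ {x y} → - y ≤ x → x ≤ y → ∣ x ∣ ≤ y
  ∣x∣≤y {x} {y} -y≤x x≤y with 0# ≤? x
  ... | yes _ = x≤y
  ... | no  _ = ≤-by (x - - y) (x≤y⇒0≤y-x -y≤x) (solve 2 (λ x y → y := :- x :+ (x :- :- y)) refl x y)

  p<½⇒0<1-2p : ∀ {p} → p < 1# / 2# → 0# < 1# - 2# * p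
  p<½⇒0<1-2p {p} p<½ = subst (0# <_) eq (*-pos (0<fromℕ-suc 1) (x<y⇒0<y-x p<½))
    where
    eq : 2# * (1# / 2# - p) ≡ 1# - 2# * p
    eq = trans (solve 2 (λ i p → # 2 :* (# 1 :* i :- p) := # 2 :* i :- # 2 :* p) refl (2# ⁻¹) p)
      (cong (_- 2# * p) (*-inverseʳ (fromℕ-suc≢0 1)))

  module _ {p : ℝ} (0≤p : 0# ≤ p) (p<½ : p < 1# / 2#) where

    s : ℝ
    s = (1# - 2# * p) ^ 2

    0<s : 0# < s
    0<s = subst (0# <_) (sym (x^2≡x*x _)) (*-pos (p<½⇒0<1-2p p<½) (p<½⇒0<1-2p p<½))

    0≤1-p : 0# ≤ 1# - p
    0≤1-p = subst (0# ≤_) (solve 1 (λ p → # 1 :- # 2 :* p :+ p := # 1 :- p) refl p)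
      (+-nonNeg (proj₁ (p<½⇒0<1-2p p<½)) 0≤p)

    s*[s⁻¹*z] : ∀ z → s * (s ⁻¹ * z) ≡ z
    s*[s⁻¹*z] = x*[x⁻¹*y]≡y (>⇒≢ 0<s)

    module _ {d : ℕ} (x y : Vec Bool d) where

      c : ℝ
      c = 2# * fromℕ d * p * (1# - p)

      dist²RR≡ : ∀ ω → dist²RR p x y ω ≡ s ⁻¹ * (publishedDistance x y ω + - c)
      dist²RR≡ ω = trans (*-comm _ _)
        (cong (λ h → s ⁻¹ * (h - c)) (dist²≡hamming (published₁ x ω) (published₂ y ω)))

      unbiased : E p (dist²RR p x y) ≡ dist² x y
      unbiased = begin
        E p (dist²RR p x y)
          ≡⟨ E-cong p dist²RR≡ ⟩
        E p (λ ω → s ⁻¹ * (publishedDistance x y ω + - c))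
          ≡⟨ E-*ˡ p {d} (s ⁻¹) _ ⟩
        s ⁻¹ * E p (λ ω → publishedDistance x y ω + - c)
          ≡⟨ cong (s ⁻¹ *_) (E-+ p (publishedDistance x y) (λ _ → - c)) ⟩
        s ⁻¹ * (E p (publishedDistance x y) + E p {d} (λ _ → - c))
          ≡⟨ cong (s ⁻¹ *_) (cong₂ _+_ (trans (E-publishedDistance p x y) (μ≡ p x y)) (E-const p d (- c))) ⟩
        s ⁻¹ * (c + s * hamming x y - c)
          ≡⟨ cong (s ⁻¹ *_) (solve 2 (λ c h → c :+ h :- c := h) refl c (s * hamming x y)) ⟩
        s ⁻¹ * (s * hamming x y)
          ≡⟨ x⁻¹*[x*y]≡y (>⇒≢ 0<s) _ ⟩
        hamming x y
          ≡⟨ dist²≡hamming x y ⟨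
        dist² x y
          ∎
        where open ≡-Reasoning

      error≡ : ∀ ω → dist²RR p x y ω - dist² x y ≡ s ⁻¹ * (publishedDistance x y ω - μ p x y)
      error≡ ω = begin
        dist²RR p x y ω - dist² x y
          ≡⟨ cong₂ _-_ (dist²RR≡ ω) (trans (dist²≡hamming x y) (sym (x⁻¹*[x*y]≡y (>⇒≢ 0<s) _))) ⟩
        s ⁻¹ * (H - c) - s ⁻¹ * (s * hamming x y)
          ≡⟨ solve 4 (λ i h c m → i :* (h :- c) :- i :* m := i :* (h :- (c :+ m))) refl (s ⁻¹) H c (s * hamming x y) ⟩
        s ⁻¹ * (H - (c + s * hamming x y))
          ≡⟨ cong (λ m → s ⁻¹ * (H - m)) (μ≡ p x y) ⟨
        s ⁻¹ * (H - μ p x y)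
          ∎
        where
        open ≡-Reasoning
        H : ℝ
        H = publishedDistance x y ω

      error-bound : ∀ {t b} ω → s * b ≡ t → publishedDistance x y ω ≤ μ p x y + t →
        μ p x y ≤ publishedDistance x y ω + t → ∣ dist²RR p x y ω - dist² x y ∣ ≤ b
      error-bound {t} {b} ω sb≡t H≤μ+t μ≤H+t = subst (λ e → ∣ e ∣ ≤ b) (sym (error≡ ω))
        (∣x∣≤y
          (*-cancelˡ-≤ 0<s (subst₂ _≤_ (trans (cong -_ (sym sb≡t)) (solve 2 (λ s b → :- (s :* b) := s :* (:- b)) refl s b))
            (sym (s*[s⁻¹*z] _))
            (≤-by (H + t - m) (x≤y⇒0≤y-x μ≤H+t) (solve 3 (λ h m t → h :- m := :- t :+ (h :+ t :- m)) refl H m t))))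
          (*-cancelˡ-≤ 0<s (subst₂ _≤_ (sym (s*[s⁻¹*z] _)) (sym sb≡t)
            (≤-by (m + t - H) (x≤y⇒0≤y-x H≤μ+t) (solve 3 (λ h m t → t := h :- m :+ (m :+ t :- h)) refl H m t)))))
        where
        H m : ℝ
        H = publishedDistance x y ω
        m = μ p x y

      -- The lower tail for (x , y) is the upper tail for the complement of x against y.
      two-sided : ∀ {v ε b} {A : Pred (Outcome d) 0ℓ} (A? : Decidable A) → 0# ≤ v →
        1# ≤ ε * exp (fromℕ d * (2# * (v * v))) → s * b ≡ fromℕ d * v →
        (∀ ω → ∣ dist²RR p x y ω - dist² x y ∣ ≤ b → A ω) → 1# ≤ Pr p A? + (ε + ε)
      two-sided {v} {ε} {b} {A} A? 0≤v 1≤e sb≡t good =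
        ≤-trans (union-bound p 0≤p 0≤1-p A? Up.tail Low.tail Up.tail-nonNeg Low.tail-nonNeg covered)
          (+-monoʳ-≤ _ (+-mono-≤ Up.E-tail≤ε Low.E-tail≤ε))
        where
        module Up = UpperTail p 0≤p 0≤1-p {d} {v} {ε} 0≤v 1≤e x y
        module Low = UpperTail p 0≤p 0≤1-p {d} {v} {ε} 0≤v 1≤e (map not x) y
        t : ℝ
        t = fromℕ d * v
        covered : ∀ ω → ¬ A ω → 1# ≤ Up.tail ω + Low.tail ω
        covered ω ¬A = cases (≤-total H (m + t)) (≤-total m (H + t))
          where
          H m : ℝ
          H = publishedDistance x y ω
          m = μ p x y
          low : H + t ≤ m → μ p (map not x) y + t ≤ publishedDistance (map not x) y ω
          low H+t≤m = subst₂ _≤_ (cong (_+ t) (sym (μ-not p x y))) (sym (publishedDistance-not x y ω))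
            (≤-by (m - (H + t)) (x≤y⇒0≤y-x H+t≤m)
              (solve 4 (λ n h m t → n :- h := n :- m :+ t :+ (m :- (h :+ t))) refl (fromℕ d) H m t))
          cases : (H ≤ m + t) ⊎ (m + t ≤ H) → (m ≤ H + t) ⊎ (H + t ≤ m) → 1# ≤ Up.tail ω + Low.tail ω
          cases (inj₂ m+t≤H) _            = ≤-trans (Up.1≤tail ω m+t≤H) (x≤x+y _ (Low.tail-nonNeg ω))
          cases (inj₁ _)     (inj₂ H+t≤m) = subst (1# ≤_) (+-comm _ _)
            (≤-trans (Low.1≤tail ω (low H+t≤m)) (x≤x+y _ (Up.tail-nonNeg ω)))
          cases (inj₁ H≤m+t) (inj₁ m≤H+t) = ⊥-elim (¬A (good ω (error-bound ω sb≡t H≤m+t m≤H+t)))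

      deviation : ∀ {δ} → 1 ℕ.≤ d → 0# < δ → δ < 1# →
        1# - δ ≤ Pr p (λ ω → ∣ dist²RR p x y ω - dist² x y ∣
                             ≤? √ (fromℕ d * log (2# / δ)) / (√ 2# * (1# - 2# * p) ^ 2))
      -- Matching on `1 ℕ.≤ d` exposes `d` as a successor, so that division by `N` is legitimate.
      deviation {δ} (ℕ.s≤s {n = n} _) 0<δ δ<1 = ≤-by (Pr p A? + (ε + ε) - 1#) (x≤y⇒0≤y-x 1≤Pr+2ε)
          (trans (solve 2 (λ q e → q := # 1 :- (e :+ e) :+ (q :+ (e :+ e) :- # 1)) refl (Pr p A?) ε)
            (cong (λ z → 1# - z + (Pr p A? + (ε + ε) - 1#)) ε+ε≡δ))
        where
        open ≡-Reasoning
        N a L r q t v ε B : ℝ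
        N = fromℕ (suc n)
        a = 2# / δ
        L = log a
        r = √ (N * L)
        q = √ 2#
        -- This t = √(dL/2) solves 2t²/d = L, so 2dv² = L at v = t/d. Each tail then receives half
        -- of δ, since exp L ≥ 2/δ.
        t = q ⁻¹ * r
        v = N ⁻¹ * t
        ε = 2# ⁻¹ * δ
        B = r / (q * s)
        A : Pred (Outcome (suc n)) 0ℓ
        A ω = ∣ dist²RR p x y ω - dist² x y ∣ ≤ B
        A? : Decidable A
        A? ω = ∣ dist²RR p x y ω - dist² x y ∣ ≤? B
        0<N : 0# < N
        0<N = 0<fromℕ-suc n
        0<2 : 0# < 2#
        0<2 = 0<fromℕ-suc 1
        δa≡2 : δ * a ≡ 2#
        δa≡2 = trans (cong (δ *_) (*-comm _ _)) (x*[x⁻¹*y]≡y (>⇒≢ 0<δ) 2#)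
        2ε≡δ : 2# * ε ≡ δ
        2ε≡δ = x*[x⁻¹*y]≡y (>⇒≢ 0<2) δ
        ε+ε≡δ : ε + ε ≡ δ
        ε+ε≡δ = trans (solve 1 (λ e → e :+ e := # 2 :* e) refl ε) 2ε≡δ
        0<ε : 0# < ε
        0<ε = *-pos (⁻¹-pos 0<2) 0<δ
        1≤a : 1# ≤ a
        1≤a = *-cancelˡ-≤ 0<δ (subst₂ _≤_ (sym (*-identityʳ δ)) (sym δa≡2)
          (≤-trans (proj₁ δ<1) (x≤x+y 1# (fromℕ-nonNeg 1))))
        0≤L : 0# ≤ L
        0≤L = log-nonNeg 1≤a
        0≤NL : 0# ≤ N * L
        0≤NL = *-nonNeg (proj₁ 0<N) 0≤L
        qq≡2 : q * q ≡ 2#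
        qq≡2 = √-square (fromℕ-nonNeg 2)
        0<q : 0# < q
        0<q = √-nonNeg (fromℕ-nonNeg 2) ,
          λ 0≡q → >⇒≢ 0<2 (trans (sym qq≡2) (trans (cong (_* q) (sym 0≡q)) (zeroˡ q)))
        qt≡r : q * t ≡ r
        qt≡r = x*[x⁻¹*y]≡y (>⇒≢ 0<q) r
        Nv≡t : N * v ≡ t
        Nv≡t = x*[x⁻¹*y]≡y (>⇒≢ 0<N) t
        0≤v : 0# ≤ v
        0≤v = *-nonNeg (proj₁ (⁻¹-pos 0<N)) (*-nonNeg (proj₁ (⁻¹-pos 0<q)) (√-nonNeg 0≤NL))
        exponent≡L : N * (2# * (v * v)) ≡ L
        exponent≡L = *-cancelˡ-≡ (>⇒≢ 0<N) (begin
          N * (N * (2# * (v * v)))        ≡⟨ solve 3 (λ n k v → n :* (n :* (k :* (v :* v))) := k :* (n :* v :* (n :* v))) refl N 2# v ⟩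
          2# * (N * v * (N * v))          ≡⟨ cong₂ (λ k z → k * (z * z)) (sym qq≡2) Nv≡t ⟩
          q * q * (t * t)                 ≡⟨ solve 2 (λ q t → q :* q :* (t :* t) := q :* t :* (q :* t)) refl q t ⟩
          q * t * (q * t)                 ≡⟨ cong (λ z → z * z) qt≡r ⟩
          r * r                           ≡⟨ √-square 0≤NL ⟩
          N * L                           ∎)
        1≤e : 1# ≤ ε * exp (N * (2# * (v * v)))
        1≤e = subst₂ _≤_ εa≡1 (cong (λ z → ε * exp z) (sym exponent≡L)) (*-monoʳ-≤ (proj₁ 0<ε) (a≤exp-log 1≤a))
          where
          εa≡1 : ε * a ≡ 1#
          εa≡1 = trans (*-assoc _ _ _) (trans (cong (2# ⁻¹ *_) δa≡2) (*-inverseˡ (>⇒≢ 0<2)))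
        sB≡Nv : s * B ≡ N * v
        sB≡Nv = trans (*-cancelˡ-≡ (>⇒≢ 0<q) (begin
          q * (s * B)                     ≡⟨ *-assoc q s B ⟨
          q * s * (r * (q * s) ⁻¹)        ≡⟨ cong (q * s *_) (*-comm r _) ⟩
          q * s * ((q * s) ⁻¹ * r)        ≡⟨ x*[x⁻¹*y]≡y (>⇒≢ (*-pos 0<q 0<s)) r ⟩
          r                               ≡⟨ qt≡r ⟨
          q * t                           ∎)) (sym Nv≡t)
        1≤Pr+2ε : 1# ≤ Pr p A? + (ε + ε)
        1≤Pr+2ε = two-sided A? 0≤v 1≤e sB≡Nv (λ ω le → le)

theorem3 : (R : RealNumbers) →
    let open RealNumbers R
        open Analysis R
        open RandomizedResponse R
    in
    (d : ℕ) → 1 ℕ.≤ d →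
    (p : ℝ) → 0# ≤ p → p < 1# / 2# →
    (x y : Vec Bool d) →
      (E p (dist²RR p x y) ≡ dist² x y)
      ×
      ((δ : ℝ) → 0# < δ → δ < 1# →
        1# - δ ≤ Pr p (λ ω → ∣ dist²RR p x y ω - dist² x y ∣
                               ≤? √ (fromℕ d * log (2# / δ)) / (√ 2# * (1# - 2# * p) ^ 2)))
theorem3 R d 1≤d p 0≤p p<½ x y = unbiased 0≤p p<½ x y , λ δ → deviation 0≤p p<½ x y 1≤d
  where open Estimator R
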